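{- Let $k>1$ be odd. Then $\gamma_{\mathrm{all}}^\infty(\Gamma_k)=\gamma(\Gamma_k)+1$.
   Context: For odd $k\ge 3$, let $G_k=\langle \rho,\tau,a : \rho^k=\tau^2=a^k=e,\ a\in Z(G_k),\ \tau\rho=\rho^{ -1}\tau\rangle$, so $G_k\cong D_{2k}\times C_k$ has order $2k^2$ ($D_{2k}$ is the dihedral group of order $2k$, $e$ the identity). For a group $G$ and an inverse-closed subset $S\subseteq G$, $\mathrm{Cay}(G,S)$ is the graph with vertex set $G$ and an edge from $u$ to $us$ for every $u\in G$, $s\in S$. Let $\Gamma_k=\mathrm{Cay}(G_k,S_k)$ where $S_k=\{\tau a^i,\rho^ia^i : 1\le i\le k-1\}\cup\{\rho\tau a,\rho\tau a^{ -1}\}$. A vertex $u$ dominates a vertex $w$ if $w=u$ or $w$ is adjacent to $u$. A dominating set is a set $D$ of vertices such that every vertex is dominated by at least one vertex of $D$; $\gamma(\Gamma)$ is the smallest size of a dominating set of $\Gamma$. Guards located at the vertices of a set $D$ (one guard per vertex) can reconfigure to a set $D'$ if there is a bijection $f:D\to D'$ such that for every $d\in D$, either $f(d)=d$ or $f(d)$ is adjacent to $d$. An eternal dominating configuration for $\Gamma$ is a nonempty collection $\mathcal D$ of subsets of $V(\Gamma)$, all of the same cardinality, such that for every $D_i\in\mathcal D$ and every vertex $w\notin D_i$ there is $D_j\in\mathcal D$ with $w\in D_j$ such that guards at $D_i$ can reconfigure to $D_j$. An eternal dominating set is a member of some eternal dominating configuration. The eternal domination number $\gamma_{\mathrm{all}}^\infty(\Gamma)$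 is the smallest cardinality of an eternal dominating set. -}

module Defs where

open import Algebra.Bundles using (Group; AbelianGroup)
import Algebra.Definitions.RawMonoid as RawMonoidDefinitions
import Algebra.Properties.AbelianGroup as AbelianGroupProperties
import Algebra.Properties.Group as GroupProperties
import Algebra.Properties.Monoid.Mult as MonoidMult
open import Algebra.Morphism.Structures using (module GroupMorphisms)
open import Algebra.Structures using (IsGroup; IsAbelianGroup)
open import Data.Bool using (Bool; true; false; T; _xor_; if_then_else_)
open import Data.Bool.Properties using (xor-assoc; xor-same; xor-identityʳ)
open import Data.Fin using (Fin; toℕ)
open import Data.Fin.Properties using (toℕ-injective; toℕ-fromℕ<; toℕ<n)
open import Data.Nat using (ℕ; zero; suc; _+_; _*_; _∸_; _≤_; _<_; s≤s; NonZero)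
open import Data.Nat.DivMod using (_%_; _/_; _mod_; m%n<n; %-distribˡ-+; m<n⇒m%n≡m; n%n≡0; m≡m%n+[m/n]*n)
import Data.Nat.Properties as ℕ
open import Data.Product using (Σ; ∃; _×_; _,_; proj₁)
open import Data.Sum using (_⊎_)
open import Function.Bundles using (_↔_; Inverse)
open import Level using (0ℓ)
open import Relation.Binary.Core using (Rel)
open import Relation.Binary.Definitions using (Symmetric)
open import Relation.Binary.PropositionalEquality using (_≡_; refl; sym; trans; cong; cong₂; subst; isEquivalence; module ≡-Reasoning)
open import Relation.Nullary using (¬_)
open import Relation.Unary using (Pred)

record Graph : Set₁ where
  field
    Vertex  : Set
    Adj     : Rel Vertex 0ℓ
    adj-sym : Symmetric Adj

IsLeast : ∀ {ℓ} → (ℕ → Set ℓ) → ℕ → Set ℓ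
IsLeast P n = P n × (∀ m → P m → n ≤ m)

module Domination (Γ : Graph) where
  open Graph Γ

  -- Only finite graphs are of interest, so sets of vertices are given by
  -- characteristic functions.  Membership is proof-irrelevant, so that
  -- `Elements D` has exactly one element for each vertex of D.
  VertexSet : Set
  VertexSet = Vertex → Bool

  infix 4 _∈_ _∉_

  _∈_ _∉_ : Vertex → VertexSet → Set
  v ∈ D = T (D v)
  v ∉ D = ¬ (v ∈ D)

  Elements : VertexSet → Set
  Elements D = Σ Vertex (_∈ D)

  HasCardinality : VertexSet → ℕ → Set
  HasCardinality D m = Fin m ↔ Elements D

  Dominates : Rel Vertex 0ℓ
  Dominates u w = w ≡ u ⊎ Adj u w

  IsDominatingSet : VertexSet → Set
  IsDominatingSet D = ∀ w → ∃ λ u → u ∈ D × Dominates u w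

  IsDominationNumber : ℕ → Set
  IsDominationNumber =
    IsLeast λ m → ∃ λ D → IsDominatingSet D × HasCardinality D m

  Reconfigurable : Rel VertexSet 0ℓ
  Reconfigurable D D′ =
    Σ (Elements D ↔ Elements D′) λ f →
      ∀ d → let d′ = Inverse.to f d in
        proj₁ d′ ≡ proj₁ d ⊎ Adj (proj₁ d) (proj₁ d′)

  record IsEternalConfiguration (𝒟 : Pred VertexSet 0ℓ) : Set where
    field
      nonempty    : ∃ λ D → 𝒟 D
      equinumeric : ∃ λ m → ∀ D → 𝒟 D → HasCardinality D m
      defend      : ∀ D → 𝒟 D → ∀ w → w ∉ D →
                    ∃ λ D′ → 𝒟 D′ × w ∈ D′ × Reconfigurable D D′

  IsEternalDominatingSet : VertexSet → Set₁
  IsEternalDominatingSet D =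
    ∃ λ (𝒟 : Pred VertexSet 0ℓ) → IsEternalConfiguration 𝒟 × 𝒟 D

  IsEternalDominationNumber : ℕ → Set₁
  IsEternalDominationNumber =
    IsLeast λ m → ∃ λ D → IsEternalDominatingSet D × HasCardinality D m

open Domination public
  using (IsDominationNumber; IsEternalDominationNumber)

module _ {A : Set} {_∙_ : A → A → A} {ε : A} {_⁻¹ : A → A} where

  Cay : IsGroup _≡_ _∙_ ε _⁻¹ → (S : Pred A 0ℓ) →
        (∀ {s} → S s → S (s ⁻¹)) → Graph
  Cay isGroup S S-inv = record
    { Vertex  = A
    ; Adj     = λ u w → ∃ λ s → S s × w ≡ u ∙ s
    ; adj-sym = λ { {u} (s , s∈S , refl) →
        s ⁻¹ , S-inv s∈S ,
        sym (trans (assoc u s (s ⁻¹))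
            (trans (cong (u ∙_) (inverseʳ s)) (identityʳ u))) }
    }
    where open IsGroup isGroup using (assoc; inverseʳ; identityʳ)

module _ {c ℓ} (H : Group c ℓ) where
  open Group H

  pow : Carrier → ℕ → Carrier
  pow x n = n ×ᴿ x
    where open RawMonoidDefinitions rawMonoid renaming (_×_ to _×ᴿ_)

  -- Commuting with the generators r and t is what makes z central in the
  -- subgroup generated by r, t and z.
  record Relations (k : ℕ) (r t z : Carrier) : Set ℓ where
    field
      rᵏ≈ε    : pow r k ≈ ε
      t²≈ε    : pow t 2 ≈ ε
      zᵏ≈ε    : pow z k ≈ ε
      zr≈rz   : z ∙ r ≈ r ∙ z
      zt≈tz   : z ∙ t ≈ t ∙ z
      tr≈r⁻¹t : t ∙ r ≈ r ⁻¹ ∙ t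

module _ (k : ℕ) .{{_ : NonZero k}} where

  infixl 6 _⊕_
  _⊕_ : Fin k → Fin k → Fin k
  i ⊕ j = (toℕ i + toℕ j) mod k

  ⊖_ : Fin k → Fin k
  ⊖ i = (k ∸ toℕ i) mod k

  toℕ-mod : ∀ n → toℕ (n mod k) ≡ n % k
  toℕ-mod n = toℕ-fromℕ< (m%n<n n k)

  mod-cong% : ∀ {m n} → m % k ≡ n % k → m mod k ≡ n mod k
  mod-cong% {m} {n} eq =
    toℕ-injective (trans (toℕ-mod m) (trans eq (sym (toℕ-mod n))))

  k-mod : k mod k ≡ 0 mod k
  k-mod = mod-cong% (trans (n%n≡0 k) (sym (0%≡0 k)))
    where
    0%≡0 : ∀ n .{{_ : NonZero n}} → 0 % n ≡ 0
    0%≡0 (suc n) = refl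

  mod-toℕ : ∀ i → toℕ i mod k ≡ i
  mod-toℕ i =
    toℕ-injective (trans (toℕ-mod (toℕ i)) (m<n⇒m%n≡m (toℕ<n i)))

  mod-+ : ∀ m n → (m mod k) ⊕ (n mod k) ≡ (m + n) mod k
  mod-+ m n = mod-cong% (trans
    (cong₂ (λ x y → (x + y) % k) (toℕ-mod m) (toℕ-mod n))
    (sym (%-distribˡ-+ m n k)))

  ⊕-comm : ∀ i j → i ⊕ j ≡ j ⊕ i
  ⊕-comm i j = cong (_mod k) (ℕ.+-comm (toℕ i) (toℕ j))

  ⊕-assoc : ∀ i j l → (i ⊕ j) ⊕ l ≡ i ⊕ (j ⊕ l)
  ⊕-assoc i j l = begin
    (i ⊕ j) ⊕ l                               ≡⟨ cong ((i ⊕ j) ⊕_) (mod-toℕ l) ⟨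
    (i ⊕ j) ⊕ (toℕ l mod k)                   ≡⟨ mod-+ (toℕ i + toℕ j) (toℕ l) ⟩
    (toℕ i + toℕ j + toℕ l) mod k             ≡⟨ cong (_mod k) (ℕ.+-assoc (toℕ i) (toℕ j) (toℕ l)) ⟩
    (toℕ i + (toℕ j + toℕ l)) mod k           ≡⟨ mod-+ (toℕ i) (toℕ j + toℕ l) ⟨
    (toℕ i mod k) ⊕ (j ⊕ l)                   ≡⟨ cong (_⊕ (j ⊕ l)) (mod-toℕ i) ⟩
    i ⊕ (j ⊕ l)                               ∎
    where open ≡-Reasoning

  ⊕-identityˡ : ∀ i → (0 mod k) ⊕ i ≡ i
  ⊕-identityˡ i = begin
    (0 mod k) ⊕ i              ≡⟨ cong ((0 mod k) ⊕_) (mod-toℕ i) ⟨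
    (0 mod k) ⊕ (toℕ i mod k)  ≡⟨ mod-+ 0 (toℕ i) ⟩
    toℕ i mod k                ≡⟨ mod-toℕ i ⟩
    i                          ∎
    where open ≡-Reasoning

  ⊖-inverseˡ : ∀ i → (⊖ i) ⊕ i ≡ 0 mod k
  ⊖-inverseˡ i = begin
    (⊖ i) ⊕ i                    ≡⟨ cong ((⊖ i) ⊕_) (mod-toℕ i) ⟨
    (⊖ i) ⊕ (toℕ i mod k)        ≡⟨ mod-+ (k ∸ toℕ i) (toℕ i) ⟩
    (k ∸ toℕ i + toℕ i) mod k    ≡⟨ cong (_mod k) (ℕ.m∸n+n≡m (ℕ.<⇒≤ (toℕ<n i))) ⟩
    k mod k                      ≡⟨ k-mod ⟩
    0 mod k                      ∎
    where open ≡-Reasoning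

  ℤ/-isAbelianGroup : IsAbelianGroup _≡_ _⊕_ (0 mod k) ⊖_
  ℤ/-isAbelianGroup = record
    { isGroup = record
      { isMonoid = record
        { isSemigroup = record
          { isMagma = record { isEquivalence = isEquivalence ; ∙-cong = cong₂ _⊕_ }
          ; assoc   = ⊕-assoc }
        ; identity = ⊕-identityˡ
                   , λ i → trans (⊕-comm i (0 mod k)) (⊕-identityˡ i) }
      ; inverse = ⊖-inverseˡ
                , λ i → trans (⊕-comm i (⊖ i)) (⊖-inverseˡ i)
      ; ⁻¹-cong = cong ⊖_ }
    ; comm = ⊕-comm }

  ℤ/ : AbelianGroup 0ℓ 0ℓ
  ℤ/ = record { isAbelianGroup = ℤ/-isAbelianGroup }

  -- The group G_k ≅ D_{2k} × C_k: the triple (i , b , j) stands for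
  -- ρⁱ τᵇ aʲ.  `G-relations` and `G-universal` below show that this is
  -- the group with the presentation
  -- ⟨ ρ, τ, a : ρᵏ = τ² = aᵏ = e, a central, τρ = ρ⁻¹τ ⟩.

  G : Set
  G = Fin k × Bool × Fin k

  -- τᵇ ρⁱ τ⁻ᵇ = ρ^(twist b i)
  twist : Bool → Fin k → Fin k
  twist b i = if b then ⊖ i else i

  infixl 7 _·_
  _·_ : G → G → G
  (i , b , j) · (i′ , b′ , j′) = i ⊕ twist b i′ , b xor b′ , j ⊕ j′

  e : G
  e = 0 mod k , false , 0 mod k

  inv : G → G
  inv (i , b , j) = twist b (⊖ i) , b , ⊖ j

  ρ τ a : G
  ρ = 1 mod k , false , 0 mod k
  τ = 0 mod k , true  , 0 mod k
  a = 0 mod k , false , 1 mod k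

  private
    module Z = AbelianGroup ℤ/
    module ZP = AbelianGroupProperties ℤ/

  twist-⊕ : ∀ b i j → twist b (i ⊕ j) ≡ twist b i ⊕ twist b j
  twist-⊕ false i j = refl
  twist-⊕ true  i j = sym (ZP.⁻¹-∙-comm i j)

  twist-twist : ∀ b c i → twist b (twist c i) ≡ twist (b xor c) i
  twist-twist false c     i = refl
  twist-twist true  false i = refl
  twist-twist true  true  i = ZP.⁻¹-involutive i

  twist-0 : ∀ b → twist b (0 mod k) ≡ 0 mod k
  twist-0 false = refl
  twist-0 true  = ZP.ε⁻¹≈ε

  ≡³ : ∀ {i i′ j j′ : Fin k} {b b′ : Bool} → i ≡ i′ → b ≡ b′ → j ≡ j′ →
       _≡_ {A = G} (i , b , j) (i′ , b′ , j′)
  ≡³ refl refl refl = refl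

  ·-assoc : ∀ x y z → (x · y) · z ≡ x · (y · z)
  ·-assoc (i , b , j) (i′ , b′ , j′) (i″ , b″ , j″) =
    ≡³ (trans (⊕-assoc i (twist b i′) (twist (b xor b′) i″))
              (cong (i ⊕_) (trans
                (cong (twist b i′ ⊕_) (sym (twist-twist b b′ i″)))
                (sym (twist-⊕ b i′ (twist b′ i″))))))
       (xor-assoc b b′ b″)
       (⊕-assoc j j′ j″)

  ·-identityˡ : ∀ x → e · x ≡ x
  ·-identityˡ (i , b , j) = ≡³ (Z.identityˡ i) refl (Z.identityˡ j)

  ·-identityʳ : ∀ x → x · e ≡ x
  ·-identityʳ (i , b , j) =
    ≡³ (trans (cong (i ⊕_) (twist-0 b)) (Z.identityʳ i))
       (xor-identityʳ b) (Z.identityʳ j)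

  ·-inverseˡ : ∀ x → inv x · x ≡ e
  ·-inverseˡ (i , b , j) =
    ≡³ (trans (sym (twist-⊕ b (⊖ i) i))
              (trans (cong (twist b) (Z.inverseˡ i)) (twist-0 b)))
       (xor-same b) (Z.inverseˡ j)

  ·-inverseʳ : ∀ x → x · inv x ≡ e
  ·-inverseʳ (i , b , j) =
    ≡³ (trans (cong (i ⊕_) (trans (twist-twist b b (⊖ i))
                                  (cong (λ c → twist c (⊖ i)) (xor-same b))))
              (Z.inverseʳ i))
       (xor-same b) (Z.inverseʳ j)

  G-isGroup : IsGroup _≡_ _·_ e inv
  G-isGroup = record
    { isMonoid = record
      { isSemigroup = record
        { isMagma = record { isEquivalence = isEquivalence ; ∙-cong = cong₂ _·_ }
        ; assoc   = ·-assoc }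
      ; identity = ·-identityˡ , ·-identityʳ }
    ; inverse = ·-inverseˡ , ·-inverseʳ
    ; ⁻¹-cong = cong inv }

  G-group : Group 0ℓ 0ℓ
  G-group = record { isGroup = G-isGroup }

  mod-suc : ∀ n → (1 mod k) ⊕ (n mod k) ≡ suc n mod k
  mod-suc n = mod-+ 1 n

  ρ^ : ∀ n → pow G-group ρ n ≡ (n mod k , false , 0 mod k)
  ρ^ zero    = refl
  ρ^ (suc n) = trans (cong (ρ ·_) (ρ^ n))
    (≡³ (mod-suc n) refl (Z.identityˡ _))

  a^ : ∀ n → pow G-group a n ≡ (0 mod k , false , n mod k)
  a^ zero    = refl
  a^ (suc n) = trans (cong (a ·_) (a^ n))
    (≡³ (Z.identityˡ _) refl (mod-suc n))

  τ⁻¹ : inv τ ≡ τ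
  τ⁻¹ = ≡³ (ZP.⁻¹-involutive (0 mod k)) refl ZP.ε⁻¹≈ε

  a-central : ∀ x → a · x ≡ x · a
  a-central (i , b , j) =
    ≡³ (trans (Z.identityˡ i)
         (sym (trans (cong (i ⊕_) (twist-0 b)) (Z.identityʳ i))))
       (sym (xor-identityʳ b))
       (Z.comm (1 mod k) j)

  G-relations : Relations G-group k ρ τ a
  G-relations = record
    { rᵏ≈ε    = trans (ρ^ k) (≡³ k-mod refl refl)
    ; t²≈ε    = trans (cong (τ ·_) (·-identityʳ τ))
                      (trans (cong (τ ·_) (sym τ⁻¹)) (·-inverseʳ τ))
    ; zᵏ≈ε    = trans (a^ k) (≡³ refl refl k-mod)
    ; zr≈rz   = a-central ρ
    ; zt≈tz   = a-central τ
    ; tr≈r⁻¹t = ≡³ (Z.comm (0 mod k) (⊖ (1 mod k))) refl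
                   (cong (_⊕ (0 mod k)) (sym ZP.ε⁻¹≈ε))
    }

  private
    τ^ : Bool → G
    τ^ b = if b then τ else e

    normal-form : ∀ i b j →
      (i , b , j) ≡ (pow G-group ρ (toℕ i) · τ^ b) · pow G-group a (toℕ j)
    normal-form i b j = sym (trans
      (cong₂ (λ x y → (x · τ^ b) · y) (ρ^ (toℕ i)) (a^ (toℕ j)))
      (lemma b))
      where
      lemma : ∀ b → ((toℕ i mod k , false , 0 mod k) · τ^ b)
                    · (0 mod k , false , toℕ j mod k) ≡ (i , b , j)
      lemma false = ≡³ (trans (Z.identityʳ _) (trans (Z.identityʳ _) (mod-toℕ i)))
        refl (trans (cong₂ _⊕_ (Z.identityˡ _) (mod-toℕ j)) (Z.identityˡ j))
      lemma true  = ≡³ (trans (cong₂ _⊕_ (trans (Z.identityʳ _) (mod-toℕ i)) ZP.ε⁻¹≈ε)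
                              (Z.identityʳ i))
        refl (trans (cong₂ _⊕_ (Z.identityˡ _) (mod-toℕ j)) (Z.identityˡ j))

  module _ {c ℓ} (H : Group c ℓ) {r t z : Group.Carrier H} where
    open Group H renaming (Carrier to C; refl to ≈-refl; sym to ≈-sym; trans to ≈-trans)
    open GroupMorphisms (Group.rawGroup G-group) rawGroup using (IsGroupHomomorphism)
    private
      module HP = GroupProperties H
      module HM = MonoidMult monoid
    open import Relation.Binary.Reasoning.Setoid setoid

    private
      infixr 8 _^_
      _^_ : C → ℕ → C
      _^_ = pow H

      t^ : Bool → C
      t^ b = if b then t else ε

      φ : G → C
      φ (i , b , j) = (r ^ toℕ i ∙ t^ b) ∙ z ^ toℕ j

      comm-^ : ∀ {x y} → x ∙ y ≈ y ∙ x → ∀ n → x ^ n ∙ y ≈ y ∙ x ^ n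
      comm-^ {x} {y} xy zero = ≈-trans (identityˡ y) (≈-sym (identityʳ y))
      comm-^ {x} {y} xy (suc n) = begin
        (x ∙ x ^ n) ∙ y  ≈⟨ assoc _ _ _ ⟩
        x ∙ (x ^ n ∙ y)  ≈⟨ ∙-congˡ (comm-^ xy n) ⟩
        x ∙ (y ∙ x ^ n)  ≈⟨ assoc _ _ _ ⟨
        (x ∙ y) ∙ x ^ n  ≈⟨ ∙-congʳ xy ⟩
        (y ∙ x) ∙ x ^ n  ≈⟨ assoc _ _ _ ⟩
        y ∙ (x ∙ x ^ n)  ∎

      ^-% : ∀ {x} → x ^ k ≈ ε → ∀ n → x ^ toℕ (n mod k) ≈ x ^ n
      ^-% {x} xᵏ n = ≈-sym (begin
        x ^ n                            ≈⟨ HM.×-congˡ {x} (m≡m%n+[m/n]*n n k) ⟩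
        x ^ (n % k + n / k * k)          ≈⟨ HM.×-homo-+ x (n % k) (n / k * k) ⟩
        x ^ (n % k) ∙ x ^ (n / k * k)    ≈⟨ ∙-congˡ (HM.×-assocˡ x (n / k) k) ⟨
        x ^ (n % k) ∙ (x ^ k) ^ (n / k)  ≈⟨ ∙-congˡ (HM.×-congʳ (n / k) xᵏ) ⟩
        x ^ (n % k) ∙ ε ^ (n / k)        ≈⟨ ∙-congˡ (ε^ (n / k)) ⟩
        x ^ (n % k) ∙ ε                  ≈⟨ identityʳ _ ⟩
        x ^ (n % k)                      ≈⟨ HM.×-congˡ {x} (toℕ-mod n) ⟨
        x ^ toℕ (n mod k)                ∎)
        where
        ε^ : ∀ m → ε ^ m ≈ ε
        ε^ zero    = ≈-refl
        ε^ (suc m) = ≈-trans (identityˡ _) (ε^ m)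

      ^-⊕ : ∀ {x} → x ^ k ≈ ε → ∀ i j → x ^ toℕ (i ⊕ j) ≈ x ^ toℕ i ∙ x ^ toℕ j
      ^-⊕ {x} xᵏ i j =
        ≈-trans (^-% xᵏ (toℕ i + toℕ j)) (HM.×-homo-+ x (toℕ i) (toℕ j))

      ^-⊖ : ∀ {x} → x ^ k ≈ ε → ∀ i → x ^ toℕ (⊖ i) ≈ (x ^ toℕ i) ⁻¹
      ^-⊖ {x} xᵏ i = HP.inverseˡ-unique _ _ (begin
        x ^ toℕ (⊖ i) ∙ x ^ toℕ i  ≈⟨ ^-⊕ xᵏ (⊖ i) i ⟨
        x ^ toℕ ((⊖ i) ⊕ i)        ≈⟨ HM.×-congˡ {x} (cong toℕ (Z.inverseˡ i)) ⟩
        x ^ toℕ (0 mod k)          ≈⟨ ^-% xᵏ 0 ⟩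
        ε                          ∎)

      module Hom (rel : Relations H k r t z) where
        open Relations rel

        t-r^ : ∀ n → t ∙ r ^ n ≈ (r ^ n) ⁻¹ ∙ t
        t-r^ zero = begin
          t ∙ ε      ≈⟨ identityʳ t ⟩
          t          ≈⟨ identityˡ t ⟨
          ε ∙ t      ≈⟨ ∙-congʳ HP.ε⁻¹≈ε ⟨
          ε ⁻¹ ∙ t   ∎
        t-r^ (suc n) = begin
          t ∙ (r ∙ r ^ n)           ≈⟨ assoc _ _ _ ⟨
          (t ∙ r) ∙ r ^ n           ≈⟨ ∙-congʳ tr≈r⁻¹t ⟩
          (r ⁻¹ ∙ t) ∙ r ^ n        ≈⟨ assoc _ _ _ ⟩
          r ⁻¹ ∙ (t ∙ r ^ n)        ≈⟨ ∙-congˡ (t-r^ n) ⟩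
          r ⁻¹ ∙ ((r ^ n) ⁻¹ ∙ t)   ≈⟨ assoc _ _ _ ⟨
          (r ⁻¹ ∙ (r ^ n) ⁻¹) ∙ t   ≈⟨ ∙-congʳ (HP.⁻¹-anti-homo-∙ (r ^ n) r) ⟨
          (r ^ n ∙ r) ⁻¹ ∙ t        ≈⟨ ∙-congʳ (⁻¹-cong (comm-^ ≈-refl n)) ⟩
          (r ∙ r ^ n) ⁻¹ ∙ t        ∎

        t^-r^ : ∀ b i → t^ b ∙ r ^ toℕ i ≈ r ^ toℕ (twist b i) ∙ t^ b
        t^-r^ false i = ≈-trans (identityˡ _) (≈-sym (identityʳ _))
        t^-r^ true  i = ≈-trans (t-r^ (toℕ i)) (∙-congʳ (≈-sym (^-⊖ rᵏ≈ε i)))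

        t^-xor : ∀ b b′ → t^ (b xor b′) ≈ t^ b ∙ t^ b′
        t^-xor false b′    = ≈-sym (identityˡ _)
        t^-xor true  false = ≈-sym (identityʳ _)
        t^-xor true  true  = ≈-sym (≈-trans (∙-congˡ (≈-sym (identityʳ t))) t²≈ε)

        z^-r^ : ∀ m n → z ^ m ∙ r ^ n ≈ r ^ n ∙ z ^ m
        z^-r^ m n = comm-^ (≈-sym (comm-^ (≈-sym zr≈rz) n)) m

        z^-t^ : ∀ m b → z ^ m ∙ t^ b ≈ t^ b ∙ z ^ m
        z^-t^ m false = ≈-trans (identityʳ _) (≈-sym (identityˡ _))
        z^-t^ m true  = comm-^ zt≈tz m

        φ-homo : ∀ x y → φ (x · y) ≈ φ x ∙ φ y
        φ-homo (i , b , j) (i′ , b′ , j′) = begin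
          (r ^ toℕ (i ⊕ twist b i′) ∙ t^ (b xor b′)) ∙ z ^ toℕ (j ⊕ j′)
            ≈⟨ ∙-cong (∙-cong (^-⊕ rᵏ≈ε i _) (t^-xor b b′)) (^-⊕ zᵏ≈ε j j′) ⟩
          ((r₁ ∙ r₃) ∙ (t₁ ∙ t₂)) ∙ (z₁ ∙ z₂)
            ≈⟨ ∙-congʳ (assoc _ _ _) ⟩
          (r₁ ∙ (r₃ ∙ (t₁ ∙ t₂))) ∙ (z₁ ∙ z₂)
            ≈⟨ ∙-congʳ (∙-congˡ (assoc _ _ _)) ⟨
          (r₁ ∙ ((r₃ ∙ t₁) ∙ t₂)) ∙ (z₁ ∙ z₂)
            ≈⟨ ∙-congʳ (∙-congˡ (∙-congʳ (t^-r^ b i′))) ⟨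
          (r₁ ∙ ((t₁ ∙ r₂) ∙ t₂)) ∙ (z₁ ∙ z₂)
            ≈⟨ ∙-congʳ (∙-congˡ (assoc _ _ _)) ⟩
          (r₁ ∙ (t₁ ∙ (r₂ ∙ t₂))) ∙ (z₁ ∙ z₂)
            ≈⟨ ∙-congʳ (assoc _ _ _) ⟨
          ((r₁ ∙ t₁) ∙ (r₂ ∙ t₂)) ∙ (z₁ ∙ z₂)
            ≈⟨ assoc _ _ _ ⟩
          (r₁ ∙ t₁) ∙ ((r₂ ∙ t₂) ∙ (z₁ ∙ z₂))
            ≈⟨ ∙-congˡ (assoc _ _ _) ⟨
          (r₁ ∙ t₁) ∙ (((r₂ ∙ t₂) ∙ z₁) ∙ z₂)
            ≈⟨ ∙-congˡ (∙-congʳ swap) ⟩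
          (r₁ ∙ t₁) ∙ ((z₁ ∙ (r₂ ∙ t₂)) ∙ z₂)
            ≈⟨ ∙-congˡ (assoc _ _ _) ⟩
          (r₁ ∙ t₁) ∙ (z₁ ∙ ((r₂ ∙ t₂) ∙ z₂))
            ≈⟨ assoc _ _ _ ⟨
          ((r₁ ∙ t₁) ∙ z₁) ∙ ((r₂ ∙ t₂) ∙ z₂) ∎
          where
          r₁ = r ^ toℕ i
          r₂ = r ^ toℕ i′
          r₃ = r ^ toℕ (twist b i′)
          t₁ = t^ b
          t₂ = t^ b′
          z₁ = z ^ toℕ j
          z₂ = z ^ toℕ j′
          swap : (r₂ ∙ t₂) ∙ z₁ ≈ z₁ ∙ (r₂ ∙ t₂)
          swap = begin
            (r₂ ∙ t₂) ∙ z₁  ≈⟨ assoc _ _ _ ⟩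
            r₂ ∙ (t₂ ∙ z₁)  ≈⟨ ∙-congˡ (z^-t^ (toℕ j) b′) ⟨
            r₂ ∙ (z₁ ∙ t₂)  ≈⟨ assoc _ _ _ ⟨
            (r₂ ∙ z₁) ∙ t₂  ≈⟨ ∙-congʳ (z^-r^ (toℕ j) (toℕ i′)) ⟨
            (z₁ ∙ r₂) ∙ t₂  ≈⟨ assoc _ _ _ ⟩
            z₁ ∙ (r₂ ∙ t₂)  ∎

        r^0 : r ^ toℕ (0 mod k) ≈ ε
        r^0 = ^-% rᵏ≈ε 0

        z^0 : z ^ toℕ (0 mod k) ≈ ε
        z^0 = ^-% zᵏ≈ε 0

        φ-ε : φ e ≈ ε
        φ-ε = ≈-trans (∙-cong (≈-trans (identityʳ _) r^0) z^0) (identityʳ ε)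

        φ-isHom : IsGroupHomomorphism φ
        φ-isHom = record
          { isMonoidHomomorphism = record
            { isMagmaHomomorphism = record
              { isRelHomomorphism = record { cong = λ { refl → ≈-refl } }
              ; homo = φ-homo }
            ; ε-homo = φ-ε }
          ; ⁻¹-homo = λ x → HP.inverseˡ-unique _ _
              (≈-trans (≈-sym (φ-homo (inv x) x))
              (≈-trans (reflexive (cong φ (·-inverseˡ x))) φ-ε)) }

        φ-ρ : φ ρ ≈ r
        φ-ρ = begin
          (r ^ toℕ (1 mod k) ∙ ε) ∙ z ^ toℕ (0 mod k)
            ≈⟨ ∙-cong (≈-trans (identityʳ _) (^-% rᵏ≈ε 1)) z^0 ⟩
          (r ∙ ε) ∙ ε  ≈⟨ identityʳ _ ⟩
          r ∙ ε        ≈⟨ identityʳ r ⟩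
          r            ∎

        φ-τ : φ τ ≈ t
        φ-τ = ≈-trans (∙-cong (≈-trans (∙-congʳ r^0) (identityˡ t)) z^0) (identityʳ t)

        φ-a : φ a ≈ z
        φ-a = begin
          (r ^ toℕ (0 mod k) ∙ ε) ∙ z ^ toℕ (1 mod k)
            ≈⟨ ∙-cong (≈-trans (identityʳ _) r^0) (^-% zᵏ≈ε 1) ⟩
          ε ∙ (z ∙ ε)  ≈⟨ identityˡ _ ⟩
          z ∙ ε        ≈⟨ identityʳ z ⟩
          z            ∎

        unique : ∀ ψ → IsGroupHomomorphism ψ →
                 ψ ρ ≈ r → ψ τ ≈ t → ψ a ≈ z → ∀ x → ψ x ≈ φ x
        unique ψ ψ-hom ψρ ψτ ψa (i , b , j) = begin
          ψ (i , b , j)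
            ≈⟨ reflexive (cong ψ (normal-form i b j)) ⟩
          ψ ((pow G-group ρ (toℕ i) · τ^ b) · pow G-group a (toℕ j))
            ≈⟨ homo _ _ ⟩
          ψ (pow G-group ρ (toℕ i) · τ^ b) ∙ ψ (pow G-group a (toℕ j))
            ≈⟨ ∙-cong (homo _ _) (ψ-pow ψa (toℕ j)) ⟩
          (ψ (pow G-group ρ (toℕ i)) ∙ ψ (τ^ b)) ∙ z ^ toℕ j
            ≈⟨ ∙-congʳ (∙-cong (ψ-pow ψρ (toℕ i)) (ψ-τ^ b)) ⟩
          φ (i , b , j) ∎
          where
          open IsGroupHomomorphism ψ-hom using (homo; ε-homo)
          ψ-pow : ∀ {x y} → ψ x ≈ y → ∀ n → ψ (pow G-group x n) ≈ y ^ n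
          ψ-pow ψx zero    = ε-homo
          ψ-pow ψx (suc n) = ≈-trans (homo _ _) (∙-cong ψx (ψ-pow ψx n))
          ψ-τ^ : ∀ b → ψ (τ^ b) ≈ t^ b
          ψ-τ^ false = ε-homo
          ψ-τ^ true  = ψτ

    G-universal : Relations H k r t z →
      ∃ λ f → IsGroupHomomorphism f × f ρ ≈ r × f τ ≈ t × f a ≈ z ×
        (∀ g → IsGroupHomomorphism g → g ρ ≈ r → g τ ≈ t → g a ≈ z →
         ∀ x → g x ≈ f x)
    G-universal rel = φ , φ-isHom , φ-ρ , φ-τ , φ-a , unique
      where open Hom rel

  private
    infixr 8 _^_
    _^_ : G → ℕ → G
    _^_ = pow G-group

  data S : Pred G 0ℓ where
    τaⁱ   : ∀ i → 1 ≤ i → i ≤ k ∸ 1 → S (τ · a ^ i)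
    ρⁱaⁱ  : ∀ i → 1 ≤ i → i ≤ k ∸ 1 → S (ρ ^ i · a ^ i)
    ρτa   : S (ρ · τ · a)
    ρτa⁻¹ : S (ρ · τ · inv a)

  private
    module GP = GroupProperties G-group

    range : ∀ {i} → 1 ≤ i → i ≤ k ∸ 1 → (1 ≤ k ∸ i) × (k ∸ i ≤ k ∸ 1) × (k ∸ i + i ≡ k)
    range {i} 1≤i i≤k-1 = ℕ.m<n⇒0<n∸m i<k , ℕ.∸-monoʳ-≤ k 1≤i , ℕ.m∸n+n≡m (ℕ.<⇒≤ i<k)
      where
      i<k : i < k
      i<k = subst (i <_) (ℕ.suc-pred k) (s≤s i≤k-1)

    pow-inv : ∀ {x} i → x ^ k ≡ e → k ∸ i + i ≡ k → inv (x ^ i) ≡ x ^ (k ∸ i)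
    pow-inv {x} i xᵏ eq = sym (GP.inverseˡ-unique _ _
      (trans (sym (×-homo-+ x (k ∸ i) i)) (trans (cong (x ^_) eq) xᵏ)))
      where open MonoidMult (Group.monoid G-group) using (×-homo-+)

    a-^ : ∀ i x → a ^ i · x ≡ x · a ^ i
    a-^ zero    x = trans (·-identityˡ x) (sym (·-identityʳ x))
    a-^ (suc i) x = begin
      (a · a ^ i) · x  ≡⟨ ·-assoc a (a ^ i) x ⟩
      a · (a ^ i · x)  ≡⟨ a-central (a ^ i · x) ⟩
      (a ^ i · x) · a  ≡⟨ cong (_· a) (a-^ i x) ⟩
      (x · a ^ i) · a  ≡⟨ ·-assoc x (a ^ i) a ⟩
      x · (a ^ i · a)  ≡⟨ cong (x ·_) (a-central (a ^ i)) ⟨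
      x · (a · a ^ i)  ∎
      where open ≡-Reasoning

    open Relations G-relations

    τa⁻ : ∀ i → k ∸ i + i ≡ k → inv (τ · a ^ i) ≡ τ · a ^ (k ∸ i)
    τa⁻ i eq = begin
      inv (τ · a ^ i)      ≡⟨ GP.⁻¹-anti-homo-∙ τ (a ^ i) ⟩
      inv (a ^ i) · inv τ  ≡⟨ cong₂ _·_ (pow-inv i zᵏ≈ε eq) τ⁻¹ ⟩
      a ^ (k ∸ i) · τ      ≡⟨ a-^ (k ∸ i) τ ⟩
      τ · a ^ (k ∸ i)      ∎
      where open ≡-Reasoning

    ρa⁻ : ∀ i → k ∸ i + i ≡ k → inv (ρ ^ i · a ^ i) ≡ ρ ^ (k ∸ i) · a ^ (k ∸ i)
    ρa⁻ i eq = begin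
      inv (ρ ^ i · a ^ i)        ≡⟨ GP.⁻¹-anti-homo-∙ (ρ ^ i) (a ^ i) ⟩
      inv (a ^ i) · inv (ρ ^ i)  ≡⟨ cong₂ _·_ (pow-inv i zᵏ≈ε eq) (pow-inv i rᵏ≈ε eq) ⟩
      a ^ (k ∸ i) · ρ ^ (k ∸ i)  ≡⟨ a-^ (k ∸ i) (ρ ^ (k ∸ i)) ⟩
      ρ ^ (k ∸ i) · a ^ (k ∸ i)  ∎
      where open ≡-Reasoning

    ρτ⁻ : inv (ρ · τ) ≡ ρ · τ
    ρτ⁻ = begin
      inv (ρ · τ)          ≡⟨ GP.⁻¹-anti-homo-∙ ρ τ ⟩
      inv τ · inv ρ        ≡⟨ cong (_· inv ρ) τ⁻¹ ⟩
      τ · inv ρ            ≡⟨ ≡³ (trans (Z.comm (0 mod k) (⊖ (⊖ (1 mod k)))) (cong (_⊕ (0 mod k)) (ZP.⁻¹-involutive (1 mod k))))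
                                 refl (cong ((0 mod k) ⊕_) ZP.ε⁻¹≈ε) ⟩
      ρ · τ                ∎
      where open ≡-Reasoning

    ρτx⁻ : ∀ x → (inv x · (ρ · τ) ≡ (ρ · τ) · inv x) → inv (ρ · τ · x) ≡ ρ · τ · inv x
    ρτx⁻ x comm = trans (GP.⁻¹-anti-homo-∙ (ρ · τ) x)
      (trans (cong (inv x ·_) ρτ⁻) comm)

    a⁻¹-comm : inv a · (ρ · τ) ≡ (ρ · τ) · inv a
    a⁻¹-comm = begin
      inv a · (ρ · τ)          ≡⟨ cong (inv a ·_) ρτ⁻ ⟨
      inv a · inv (ρ · τ)      ≡⟨ GP.⁻¹-anti-homo-∙ (ρ · τ) a ⟨
      inv ((ρ · τ) · a)        ≡⟨ cong inv (a-central (ρ · τ)) ⟨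
      inv (a · (ρ · τ))        ≡⟨ GP.⁻¹-anti-homo-∙ a (ρ · τ) ⟩
      inv (ρ · τ) · inv a      ≡⟨ cong (_· inv a) ρτ⁻ ⟩
      (ρ · τ) · inv a          ∎
      where open ≡-Reasoning

  S-inverse-closed : ∀ {s} → S s → S (inv s)
  S-inverse-closed (τaⁱ i 1≤i i≤k-1) with range 1≤i i≤k-1
  ... | p , q , eq = subst S (sym (τa⁻ i eq)) (τaⁱ (k ∸ i) p q)
  S-inverse-closed (ρⁱaⁱ i 1≤i i≤k-1) with range 1≤i i≤k-1
  ... | p , q , eq = subst S (sym (ρa⁻ i eq)) (ρⁱaⁱ (k ∸ i) p q)
  S-inverse-closed ρτa = subst S (sym (ρτx⁻ a a⁻¹-comm)) ρτa⁻¹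
  S-inverse-closed ρτa⁻¹ = subst S
    (sym (trans (ρτx⁻ (inv a) (trans (cong (_· (ρ · τ)) a⁻⁻) (trans (a-central (ρ · τ)) (cong ((ρ · τ) ·_) (sym a⁻⁻)))))
                (cong (ρ · τ ·_) a⁻⁻)))
    ρτa
    where
    a⁻⁻ : inv (inv a) ≡ a
    a⁻⁻ = GP.⁻¹-involutive a

  Γ : Graph
  Γ = Cay G-isGroup S S-inverse-closed

{-# OPTIONS --safe #-}
module Submission where

open import Data.Nat using (ℕ; _+_; _<_; NonZero)
open import Data.Nat.DivMod using (_%_)
open import Data.Product using (∃; _×_)
open import Relation.Binary.PropositionalEquality using (_≡_)
open import Defs using (Γ; IsDominationNumber; IsEternalDominationNumber)

open import Algebra.Bundles using (AbelianGroup; CommutativeMonoid)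
import Algebra.Properties.CommutativeMonoid.Sum as SumProperties
import Algebra.Properties.CommutativeSemigroup as CommutativeSemigroupProperties
import Algebra.Properties.Group as GroupProperties
import Algebra.Properties.Semiring.Sum as SemiringSumProperties
import Algebra.Solver.CommutativeMonoid.Normal as CommutativeMonoidNormal
open import Data.Bool using (Bool; true; false; not; _xor_; if_then_else_)
open import Data.Bool.Properties using (T-irrelevant; T?; not-¬; not-involutive; xor-comm; xor-identityʳ; xor-same)
  renaming (_≟_ to _≟ᵇ_)
open import Data.Fin using (Fin; zero; suc; toℕ; _≟_)
open import Data.Fin.Patterns using (0F; 1F; 2F)
open import Data.Fin.Permutation using (transpose)
open import Data.Fin.Properties using (any?; injective⇒≤; toℕ-injective; toℕ<n)
open import Data.Nat using (zero; suc; _*_; _∸_; _≤_; z≤n; s≤s)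
open import Data.Nat.DivMod using (_/_; _mod_; m<n⇒m%n≡m; m%n%n≡m%n; m*n%n≡0; %-distribˡ-*; [m+kn]%n≡m%n; m≡m%n+[m/n]*n)
import Data.Nat.Properties as ℕ
open import Data.Nat.Tactic.RingSolver using (solve-∀)
open import Data.Product using (_,_; proj₁; proj₂)
open import Data.Product.Properties using (≡-dec)
open import Data.Sum using (_⊎_; inj₁; inj₂; [_,_]′)
open import Data.Vec using ([]; _∷_)
import Defs
open Defs using (Graph; module Domination; ≡³; a^; ρ^; twist-0; S; τaⁱ; ρⁱaⁱ; ρτa; ρτa⁻¹)
open import Function.Base using (_∘_; id)
open import Function.Bundles using (_↔_; Inverse; mk↔ₛ′)
open import Function.Properties.Inverse using (↔-sym; ↔-trans)
open import Relation.Binary.PropositionalEquality using (_≢_; refl; sym; trans; cong; cong₂; subst; module ≡-Reasoning)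
open import Relation.Nullary using (¬_; yes; no; does; contradiction)
open import Relation.Nullary.Decidable using (⌊_⌋; dec-true; toWitness; fromWitness; _×-dec_)

-- Write (i , b , j) for ρⁱ τᵇ aʲ.  The layers b = false and b = true split into
-- k cliques that meet each column i in exactly one vertex, and a guard dominates
-- vertices of only two columns in the opposite layer.  So a clique without a
-- guard calls for at least k / 2 guards in the other layer.
-- As k is odd, a dominating set of size at most k must therefore have a guard
-- in every clique of one layer; hence γ ≥ k, and k guards all lie in one layer.
-- Counting then shows that they occupy each column once, on a line j = c ∓ i.
-- When a vertex opposite to a guard is attacked, k guards would have to cross
-- to a line in the other layer, all of them moving one column along, which the
-- slopes of the two lines forbid.
--
-- Conversely an antidiagonal {(m + l , false , m − l)} dominates.  Add one
-- guard in the layer true.  Guards of the antidiagonal reach any other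
-- antidiagonal within their cliques, which answers attacks on the layer false;
-- when a vertex of the layer true is attacked, some guard of the antidiagonal
-- moves there and the extra guard takes over its clique.

-- An equation in an abelian group is decided by writing both sides as
-- differences of elements of the free commutative monoid and moving the
-- subtrahends across.
module AbelianGroupSolver {c ℓ} (A : AbelianGroup c ℓ) where
  open AbelianGroup A renaming (refl to ≈-refl; sym to ≈-sym; trans to ≈-trans)
  open GroupProperties group using (∙-cancelʳ)
  open CommutativeSemigroupProperties
    (CommutativeMonoid.commutativeSemigroup commutativeMonoid) using (interchange)
  module M = CommutativeMonoidNormal commutativeMonoid
  open import Relation.Binary.Reasoning.Setoid setoid

  infixl 6 _:+_
  infix 8 :-_

  data Expr (n : ℕ) : Set where
    var  : Fin n → Expr n
    _:+_ : Expr n → Expr n → Expr n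
    :-_  : Expr n → Expr n

  ⟦_⟧ : ∀ {n} → Expr n → M.Env n → Carrier
  ⟦ var i  ⟧ η = M.⟦ M.var i ⟧ η
  ⟦ s :+ t ⟧ η = ⟦ s ⟧ η ∙ ⟦ t ⟧ η
  ⟦ :- t   ⟧ η = ⟦ t ⟧ η ⁻¹

  pos neg : ∀ {n} → Expr n → M.Expr n
  pos (var i)  = M.var i
  pos (s :+ t) = pos s M.⊕ pos t
  pos (:- t)   = neg t
  neg (var i)  = M.id
  neg (s :+ t) = neg s M.⊕ neg t
  neg (:- t)   = pos t

  split : ∀ {n} (t : Expr n) η → ⟦ t ⟧ η ∙ M.⟦ neg t ⟧ η ≈ M.⟦ pos t ⟧ η
  split (var i)  η = identityʳ _
  split (s :+ t) η = ≈-trans (interchange _ _ _ _) (∙-cong (split s η) (split t η))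
  split (:- t)   η = begin
    ⟦ t ⟧ η ⁻¹ ∙ M.⟦ pos t ⟧ η                ≈⟨ ∙-congˡ (split t η) ⟨
    ⟦ t ⟧ η ⁻¹ ∙ (⟦ t ⟧ η ∙ M.⟦ neg t ⟧ η)    ≈⟨ assoc _ _ _ ⟨
    (⟦ t ⟧ η ⁻¹ ∙ ⟦ t ⟧ η) ∙ M.⟦ neg t ⟧ η    ≈⟨ ∙-congʳ (inverseˡ _) ⟩
    ε ∙ M.⟦ neg t ⟧ η                         ≈⟨ identityˡ _ ⟩
    M.⟦ neg t ⟧ η                             ∎

  prove : ∀ {n} (s t : Expr n) →
          M.normalise (pos s M.⊕ neg t) ≡ M.normalise (pos t M.⊕ neg s) →
          ∀ η → ⟦ s ⟧ η ≈ ⟦ t ⟧ η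
  prove s t eq η = ∙-cancelʳ (s⁻ ∙ t⁻) _ _ (begin
    ⟦ s ⟧ η ∙ (s⁻ ∙ t⁻)     ≈⟨ assoc _ _ _ ⟨
    (⟦ s ⟧ η ∙ s⁻) ∙ t⁻     ≈⟨ ∙-congʳ (split s η) ⟩
    M.⟦ pos s M.⊕ neg t ⟧ η ≈⟨ M.correct (pos s M.⊕ neg t) η ⟨
    M.⟦ M.normalise (pos s M.⊕ neg t) ⟧⇓ η ≡⟨ cong (λ nf → M.⟦ nf ⟧⇓ η) eq ⟩
    M.⟦ M.normalise (pos t M.⊕ neg s) ⟧⇓ η ≈⟨ M.correct (pos t M.⊕ neg s) η ⟩
    M.⟦ pos t M.⊕ neg s ⟧ η ≈⟨ ∙-congʳ (split t η) ⟨
    (⟦ t ⟧ η ∙ t⁻) ∙ s⁻     ≈⟨ assoc _ _ _ ⟩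
    ⟦ t ⟧ η ∙ (t⁻ ∙ s⁻)     ≈⟨ ∙-congˡ (comm t⁻ s⁻) ⟩
    ⟦ t ⟧ η ∙ (s⁻ ∙ t⁻)     ∎)
    where
    s⁻ = M.⟦ neg s ⟧ η
    t⁻ = M.⟦ neg t ⟧ η

-- Sums over Fin n

open SumProperties ℕ.+-0-commutativeMonoid
  using (sum; sum-syntax; sum-cong-≗; sum-replicate-zero; ∑-distrib-+; ∑-comm)
open SemiringSumProperties ℕ.+-*-semiring using (*-distribˡ-sum; *-distribʳ-sum)

private
  variable
    m n : ℕ

∑-mono : {f g : Fin n → ℕ} → (∀ i → f i ≤ g i) → sum f ≤ sum g
∑-mono {zero}  f≤g = z≤n
∑-mono {suc n} f≤g = ℕ.+-mono-≤ (f≤g zero) (∑-mono (f≤g ∘ suc))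

∑-const : ∀ n c → ∑[ i < n ] c ≡ n * c
∑-const zero    c = refl
∑-const (suc n) c = cong (c +_) (∑-const n c)

-- The tail already sums to at least `n * c`, which leaves the head no room above `c`; the tail sum
-- is then exact and the argument recurs.
∑-tight : ∀ {c} {f : Fin n → ℕ} → (∀ i → c ≤ f i) → sum f ≡ n * c → ∀ i → f i ≡ c
∑-tight {suc n} {c} {f} c≤f eq = λ { zero → head≡ ; (suc i) → ∑-tight (c≤f ∘ suc) tail≡ i }
  where
  n*c≤ : n * c ≤ sum (f ∘ suc)
  n*c≤ = subst (_≤ sum (f ∘ suc)) (∑-const n c) (∑-mono (c≤f ∘ suc))
  head≡ : f zero ≡ c
  head≡ = ℕ.≤-antisym
    (ℕ.+-cancelʳ-≤ (n * c) (f zero) c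
      (ℕ.≤-trans (ℕ.+-monoʳ-≤ (f zero) n*c≤) (ℕ.≤-reflexive eq)))
    (c≤f zero)
  tail≡ : sum (f ∘ suc) ≡ n * c
  tail≡ = ℕ.+-cancelˡ-≡ c _ _ (trans (cong (_+ sum (f ∘ suc)) (sym head≡)) eq)

∑-positive : {f : Fin n → ℕ} → 1 ≤ sum f → ∃ λ i → 1 ≤ f i
∑-positive {suc n} {f} 1≤∑ with f zero in eq
... | suc _ = zero , subst (1 ≤_) (sym eq) (s≤s z≤n)
... | zero  = let i , 1≤fi = ∑-positive 1≤∑ in suc i , 1≤fi

-- The Kronecker delta. Using only the `does` of the decision makes `δ (suc i) (suc j)` reduce to
-- `δ i j`, on which the recursion in `∑-δ` relies.
δ : Fin n → Fin n → ℕ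
δ i j = if does (i ≟ j) then 1 else 0

∑-δ : (j : Fin n) → ∑[ i < n ] δ i j ≡ 1
∑-δ {suc n} zero    = cong suc (sum-replicate-zero n)
∑-δ {suc n} (suc j) = ∑-δ j

δ-≡ : {i j : Fin n} → i ≡ j → δ i j ≡ 1
δ-≡ {i = i} {j} i≡j = cong (if_then 1 else 0) (dec-true (i ≟ j) i≡j)

δ-≤ : {i : Fin n} {x : ℕ} {j : Fin n} → (i ≡ j → 1 ≤ x) → δ i j ≤ x
δ-≤ {i = i} {j = j} 1≤x with i ≟ j
... | yes i≡j = 1≤x i≡j
... | no  _   = z≤n

≤-δ : {i j : Fin n} → 1 ≤ δ i j → i ≡ j
≤-δ {i = i} {j} 1≤δ with i ≟ j
... | yes i≡j = i≡j

2≤∑ : {h : Fin n → ℕ} {j l : Fin n} → j ≢ l → 1 ≤ h j → 1 ≤ h l → 2 ≤ sum h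
2≤∑ {n} {h} {j} {l} j≢l 1≤hj 1≤hl = subst (_≤ sum h) ∑≡2 (∑-mono δ+δ≤h)
  where
  δ+δ≤h : ∀ i → δ i j + δ i l ≤ h i
  δ+δ≤h i with i ≟ j | i ≟ l
  ... | yes i≡j  | yes i≡l  = contradiction (trans (sym i≡j) i≡l) j≢l
  ... | yes refl | no _     = 1≤hj
  ... | no _     | yes refl = 1≤hl
  ... | no _     | no _     = z≤n
  ∑≡2 : ∑[ i < n ] (δ i j + δ i l) ≡ 2
  ∑≡2 = trans (∑-distrib-+ (λ i → δ i j) (λ i → δ i l)) (cong₂ _+_ (∑-δ j) (∑-δ l))

1≤∑ : (f : Fin n → ℕ) (i : Fin n) → 1 ≤ f i → 1 ≤ sum f
1≤∑ {suc n} f zero    1≤fi = ℕ.≤-trans 1≤fi (ℕ.m≤m+n (f zero) _)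
1≤∑ {suc n} f (suc i) 1≤fi = ℕ.≤-trans (1≤∑ (f ∘ suc) i 1≤fi) (ℕ.m≤n+m _ (f zero))

-- Double counting of the weights `F l i`: every `i` receives at least one, every `l` gives at most
-- `w l`.
cover-≤ : (F : Fin m → Fin n → ℕ) (w : Fin m → ℕ) →
          (∀ i → ∃ λ l → 1 ≤ F l i) → (∀ l → sum (F l) ≤ w l) → n ≤ sum w
cover-≤ {m} {n} F w covered sum≤w = begin
  n                            ≡⟨ ℕ.*-identityʳ n ⟨
  n * 1                        ≡⟨ ∑-const n 1 ⟨
  ∑[ i < n ] 1                 ≤⟨ ∑-mono (λ i → let l , 1≤F = covered i in 1≤∑ (λ l → F l i) l 1≤F) ⟩
  ∑[ i < n ] ∑[ l < m ] F l i  ≡⟨ ∑-comm (λ i l → F l i) ⟩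
  ∑[ l < m ] ∑[ i < n ] F l i  ≤⟨ ∑-mono sum≤w ⟩
  sum w                        ∎
  where
  open ℕ.≤-Reasoning

fibre : (Fin m → Fin n) → Fin n → ℕ
fibre {m} x i = ∑[ l < m ] δ i (x l)

∑-fibre : (x : Fin m → Fin n) → ∑[ i < n ] fibre x i ≡ m
∑-fibre {m} {n} x = trans (∑-comm (λ i l → δ i (x l)))
  (trans (sum-cong-≗ (λ l → ∑-δ (x l))) (trans (∑-const m 1) (ℕ.*-identityʳ m)))

fibre-unique : (x : Fin m → Fin n) {i : Fin n} → fibre x i ≡ 1 →
               ∀ {l l′} → i ≡ x l → i ≡ x l′ → l ≡ l′
fibre-unique x {i} eq {l} {l′} i≡xl i≡xl′ with l ≟ l′
... | yes l≡l′ = l≡l′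
... | no  l≢l′ = contradiction
  (2≤∑ {h = λ l → δ i (x l)} l≢l′ (ℕ.≤-reflexive (sym (δ-≡ i≡xl))) (ℕ.≤-reflexive (sym (δ-≡ i≡xl′))))
  (λ 2≤ → contradiction (subst (2 ≤_) eq 2≤) λ { (s≤s ()) })

-- Every fibre is nonempty and the `n` fibres have total size `n`, so `∑-tight` makes each of them a
-- singleton.
surjective⇒injective : {x : Fin n → Fin n} → (∀ i → ∃ λ l → i ≡ x l) →
                       ∀ {l l′} → x l ≡ x l′ → l ≡ l′
surjective⇒injective {n} {x} surj {l} eq = fibre-unique x (fibre≡1 (x l)) refl eq
  where
  fibre≡1 : ∀ i → fibre x i ≡ 1
  fibre≡1 = ∑-tight (λ i → let l , i≡xl = surj i in
                      1≤∑ (λ l → δ i (x l)) l (ℕ.≤-reflexive (sym (δ-≡ i≡xl))))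
                    (trans (∑-fibre x) (sym (ℕ.*-identityʳ n)))

ι : Bool → Bool → ℕ
ι b b′ = if does (b ≟ᵇ b′) then 1 else 0

ι-refl : ∀ b → ι b b ≡ 1
ι-refl true  = refl
ι-refl false = refl

ι-total : ∀ b → ι true b + ι false b ≡ 1
ι-total true  = refl
ι-total false = refl

-- Labelled guards and their moves in an arbitrary graph.

module DominationProperties (H : Graph) where
  open Graph H
  open Domination H

  element-≡ : ∀ {D} {u v : Elements D} → proj₁ u ≡ proj₁ v → u ≡ v
  element-≡ {u = u , p} {.u , q} refl = cong (u ,_) (T-irrelevant p q)

  enumerate : ∀ {n D} (g : Fin n → Vertex) → (∀ l → g l ∈ D) →
              (∀ {l l′} → g l ≡ g l′ → l ≡ l′) →
              (∀ v → v ∈ D → ∃ λ l → g l ≡ v) → HasCardinality D n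
  enumerate {D = D} g g∈D g-injective g-surjective = mk↔ₛ′
    (λ l → g l , g∈D l)
    (λ (v , v∈D) → proj₁ (g-surjective v v∈D))
    (λ (v , v∈D) → element-≡ {D} (proj₂ (g-surjective v v∈D)))
    (λ l → g-injective (proj₂ (g-surjective (g l) (g∈D l))))

  reconfigure : ∀ {n D D′} (e : HasCardinality D n) (e′ : HasCardinality D′ n) →
                (∀ l → Dominates (proj₁ (Inverse.to e l)) (proj₁ (Inverse.to e′ l))) →
                Reconfigurable D D′
  reconfigure e e′ moves = ↔-trans (↔-sym e) e′ , λ d →
    subst (λ d₀ → Dominates (proj₁ d₀) (proj₁ (Inverse.to e′ (Inverse.from e d))))
          (Inverse.strictlyInverseˡ e d) (moves (Inverse.from e d))

  -- Indexing guards by `Fin m` turns counting them into sums over labels, and lets a guard keep its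
  -- label when it moves.
  DominatingFamily : ∀ {m} → (Fin m → Vertex) → Set
  DominatingFamily g = ∀ w → ∃ λ l → Dominates (g l) w

  dominatingFamily : ∀ {m D} → IsDominatingSet D → (e : HasCardinality D m) →
                     DominatingFamily (λ l → proj₁ (Inverse.to e l))
  dominatingFamily D-dominating e w with u , u∈D , u-dominates ← D-dominating w =
    Inverse.from e (u , u∈D) ,
    subst (λ d → Dominates (proj₁ d) w) (sym (Inverse.strictlyInverseˡ e (u , u∈D))) u-dominates

  -- An unoccupied vertex can be attacked. The guard that answers stays or moves along one edge, so
  -- its starting vertex dominates the attacked one.
  configuration-dominating : ∀ {𝒟} → IsEternalConfiguration 𝒟 → ∀ D → 𝒟 D → IsDominatingSet D
  configuration-dominating 𝒟-eternal D D∈𝒟 w with T? (D w)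
  ... | yes w∈D = w , w∈D , inj₁ refl
  ... | no  w∉D
    with D′ , _ , w∈D′ , f , moves ← IsEternalConfiguration.defend 𝒟-eternal D D∈𝒟 w w∉D =
    proj₁ u , proj₂ u ,
    subst (Dominates (proj₁ u)) (cong proj₁ (Inverse.strictlyInverseˡ f (w , w∈D′))) (moves u)
    where u = Inverse.from f (w , w∈D′)

module OddOrder (k : ℕ) .{{_ : NonZero k}} (1<k : 1 < k) (odd : k % 2 ≡ 1) where

  open AbelianGroup (Defs.ℤ/ k) using (identityˡ; identityʳ; inverseʳ)
    renaming (_∙_ to infixl 6 _⊕_; _⁻¹ to infix 8 ⊖_; ε to 𝟘)
  open GroupProperties (AbelianGroup.group (Defs.ℤ/ k)) using (identityʳ-unique; ∙-cancelˡ; ∙-cancelʳ; ⁻¹-injective; ε⁻¹≈ε)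
  module Solver = AbelianGroupSolver (Defs.ℤ/ k)
  open Solver using (prove; var; _:+_; :-_)

  G : Set
  G = Defs.G k

  𝟙 : Fin k
  𝟙 = 1 mod k

  twist : Bool → Fin k → Fin k
  twist = Defs.twist k

  infixl 7 _·_
  _·_ : G → G → G
  _·_ = Defs._·_ k

  open Domination (Γ k) hiding (IsDominationNumber; IsEternalDominationNumber)
  open DominationProperties (Γ k)

  -- Arithmetic modulo an odd `k`.

  toℕ-mod-< : ∀ {n} → n < k → toℕ (n mod k) ≡ n
  toℕ-mod-< {n} n<k = trans (Defs.toℕ-mod k n) (m<n⇒m%n≡m n<k)

  toℕ-𝟘 : toℕ 𝟘 ≡ 0
  toℕ-𝟘 = toℕ-mod-< (ℕ.<-trans (s≤s z≤n) 1<k)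

  mod≢𝟘 : ∀ {n} → 1 ≤ n → n < k → n mod k ≢ 𝟘
  mod≢𝟘 1≤n n<k eq = contradiction 1≤n (ℕ.<⇒≱ (s≤s (ℕ.≤-reflexive
    (trans (sym (toℕ-mod-< n<k)) (trans (cong toℕ eq) toℕ-𝟘)))))

  -- As `k` is odd, `suc (k / 2)` is (k + 1) / 2, the inverse of 2 modulo `k`.
  half : Fin k → Fin k
  half i = (suc (k / 2) * toℕ i) mod k

  suc[k/2]*2t : ∀ t → (suc (k / 2) * (t + t)) % k ≡ t % k
  suc[k/2]*2t t = begin
    (suc (k / 2) * (t + t)) % k       ≡⟨ cong (_% k) (rearrange (k / 2) t) ⟩
    (t + t * (1 + k / 2 * 2)) % k     ≡⟨ cong (λ n → (t + t * n) % k) k≡ ⟨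
    (t + t * k) % k                   ≡⟨ [m+kn]%n≡m%n t t k ⟩
    t % k                             ∎
    where
    open ≡-Reasoning
    k≡ : k ≡ 1 + k / 2 * 2
    k≡ = trans (m≡m%n+[m/n]*n k 2) (cong (_+ k / 2 * 2) odd)
    rearrange : ∀ n t → suc n * (t + t) ≡ t + t * (1 + n * 2)
    rearrange = solve-∀

  double-half : ∀ i → half i ⊕ half i ≡ i
  double-half i = begin
    half i ⊕ half i                          ≡⟨ Defs.mod-+ k (h * toℕ i) (h * toℕ i) ⟩
    (h * toℕ i + h * toℕ i) mod k            ≡⟨ cong (_mod k) (ℕ.*-distribˡ-+ h (toℕ i) (toℕ i)) ⟨
    (h * (toℕ i + toℕ i)) mod k              ≡⟨ Defs.mod-cong% k (suc[k/2]*2t (toℕ i)) ⟩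
    toℕ i mod k                              ≡⟨ Defs.mod-toℕ k i ⟩
    i                                        ∎
    where
    open ≡-Reasoning
    h = suc (k / 2)

  half-double : ∀ i → half (i ⊕ i) ≡ i
  half-double i = trans (Defs.mod-cong% k (begin
    (h * toℕ (i ⊕ i)) % k                ≡⟨ cong (λ n → (h * n) % k) (Defs.toℕ-mod k (t + t)) ⟩
    (h * ((t + t) % k)) % k              ≡⟨ %-distribˡ-* h ((t + t) % k) k ⟩
    ((h % k) * ((t + t) % k % k)) % k    ≡⟨ cong (λ n → ((h % k) * n) % k) (m%n%n≡m%n (t + t) k) ⟩
    ((h % k) * ((t + t) % k)) % k        ≡⟨ %-distribˡ-* h (t + t) k ⟨
    (h * (t + t)) % k                    ≡⟨ suc[k/2]*2t t ⟩
    t % k                                ∎)) (Defs.mod-toℕ k i)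
    where
    open ≡-Reasoning
    h = suc (k / 2)
    t = toℕ i

  double-injective : ∀ {i j} → i ⊕ i ≡ j ⊕ j → i ≡ j
  double-injective {i} {j} eq =
    trans (sym (half-double i)) (trans (cong half eq) (half-double j))

  double≢𝟘 : ∀ {i} → i ≢ 𝟘 → i ⊕ i ≢ 𝟘
  double≢𝟘 i≢𝟘 eq = i≢𝟘 (double-injective (trans eq (sym (identityˡ 𝟘))))

  𝟙≢𝟘 : 𝟙 ≢ 𝟘
  𝟙≢𝟘 = mod≢𝟘 (s≤s z≤n) 1<k

  𝟚≢𝟘 : 𝟙 ⊕ 𝟙 ≢ 𝟘
  𝟚≢𝟘 = double≢𝟘 𝟙≢𝟘

  𝟜≢𝟘 : (𝟙 ⊕ 𝟙) ⊕ (𝟙 ⊕ 𝟙) ≢ 𝟘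
  𝟜≢𝟘 = double≢𝟘 𝟚≢𝟘

  𝟘⊕𝟘 : 𝟘 ⊕ 𝟘 ≡ 𝟘
  𝟘⊕𝟘 = identityˡ 𝟘

  ⊕-twist-𝟘 : ∀ i b → i ⊕ twist b 𝟘 ≡ i
  ⊕-twist-𝟘 i b = trans (cong (i ⊕_) (twist-0 k b)) (identityʳ i)

  -- Adjacency in coordinates

  -- Right multiplication by generators: `SameClique` comes from ρⁱaⁱ, with `d` = 𝟘 for the vertex
  -- itself, and `Cross` from τaⁱ, ρτa and ρτa⁻¹. Thus `Reach` is the closed neighbourhood.
  SameClique Cross Reach : G → G → Set
  SameClique (i , b , j) (i′ , b′ , j′) =
    b′ ≡ b × ∃ λ d → i′ ≡ i ⊕ twist b d × j′ ≡ j ⊕ d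
  Cross (i , b , j) (i′ , b′ , j′) =
    b′ ≡ not b ×
    ((i′ ≡ i × j′ ≢ j) ⊎ (i′ ≡ i ⊕ twist b 𝟙 × (j′ ≡ j ⊕ 𝟙 ⊎ j′ ≡ j ⊕ ⊖ 𝟙)))
  Reach u w = SameClique u w ⊎ Cross u w

  τaⁱ≡ : ∀ n → Defs.τ k · Defs.pow (Defs.G-group k) (Defs.a k) n ≡ (𝟘 , true , n mod k)
  τaⁱ≡ n = trans (cong (Defs.τ k ·_) (a^ k n))
    (≡³ k (⊕-twist-𝟘 𝟘 true) refl (identityˡ _))

  ρⁱaⁱ≡ : ∀ n → Defs.pow (Defs.G-group k) (Defs.ρ k) n · Defs.pow (Defs.G-group k) (Defs.a k) n
              ≡ (n mod k , false , n mod k)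
  ρⁱaⁱ≡ n = trans (cong₂ _·_ (ρ^ k n) (a^ k n)) (≡³ k (identityʳ _) refl (identityˡ _))

  ρτa≡ : Defs.ρ k · Defs.τ k · Defs.a k ≡ (𝟙 , true , 𝟙)
  ρτa≡ = ≡³ k (trans (⊕-twist-𝟘 _ true) (identityʳ 𝟙)) refl
              (trans (cong (_⊕ 𝟙) 𝟘⊕𝟘) (identityˡ 𝟙))

  ρτa⁻¹≡ : Defs.ρ k · Defs.τ k · Defs.inv k (Defs.a k) ≡ (𝟙 , true , ⊖ 𝟙)
  ρτa⁻¹≡ = ≡³ k
    (trans (cong (λ x → 𝟙 ⊕ 𝟘 ⊕ ⊖ x) (twist-0 k true))
           (trans (⊕-twist-𝟘 _ true) (identityʳ 𝟙)))
    refl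
    (trans (cong (_⊕ ⊖ 𝟙) 𝟘⊕𝟘) (identityˡ (⊖ 𝟙)))

  ≤pred⇒< : ∀ {n} → n ≤ k ∸ 1 → n < k
  ≤pred⇒< n≤ = subst (_ <_) (ℕ.suc-pred k) (s≤s n≤)

  xor-true : ∀ b → b xor true ≡ not b
  xor-true b = xor-comm b true

  -- The generators in coordinates. That `along` admits 𝟘, the identity, is harmless because `Reach`
  -- describes closed neighbourhoods.
  data Step : G → Set where
    across : ∀ {d} → d ≢ 𝟘 → Step (𝟘 , true , d)
    along  : ∀ d → Step (d , false , d)
    diag⁺  : Step (𝟙 , true , 𝟙)
    diag⁻  : Step (𝟙 , true , ⊖ 𝟙)

  S⇒Step : ∀ {s} → S k s → Step s
  S⇒Step (τaⁱ n 1≤n n≤)  = subst Step (sym (τaⁱ≡ n)) (across (mod≢𝟘 1≤n (≤pred⇒< n≤)))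
  S⇒Step (ρⁱaⁱ n 1≤n n≤) = subst Step (sym (ρⁱaⁱ≡ n)) (along (n mod k))
  S⇒Step ρτa             = subst Step (sym ρτa≡) diag⁺
  S⇒Step ρτa⁻¹           = subst Step (sym ρτa⁻¹≡) diag⁻

  dominates⇒reach : ∀ {u w} → Dominates u w → Reach u w
  dominates⇒reach {i , b , j} (inj₁ refl) =
    inj₁ (refl , 𝟘 , sym (⊕-twist-𝟘 i b) , sym (identityʳ j))
  dominates⇒reach {i , b , j} (inj₂ (s , s∈S , refl)) with S⇒Step s∈S
  ... | across d≢𝟘 =
    inj₂ (xor-true b , inj₁ (⊕-twist-𝟘 i b , λ eq → d≢𝟘 (identityʳ-unique j _ eq)))
  ... | along d    = inj₁ (xor-identityʳ b , d , refl , refl)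
  ... | diag⁺      = inj₂ (xor-true b , inj₂ (refl , inj₁ refl))
  ... | diag⁻      = inj₂ (xor-true b , inj₂ (refl , inj₂ refl))

  1≤toℕ : ∀ {d} → d ≢ 𝟘 → 1 ≤ toℕ d
  1≤toℕ d≢𝟘 = ℕ.n≢0⇒n>0 (λ eq → d≢𝟘 (toℕ-injective (trans eq (sym toℕ-𝟘))))

  S-τ : ∀ {d} → d ≢ 𝟘 → S k (𝟘 , true , d)
  S-τ {d} d≢𝟘 = subst (S k) (trans (τaⁱ≡ (toℕ d)) (≡³ k refl refl (Defs.mod-toℕ k d)))
    (τaⁱ (toℕ d) (1≤toℕ d≢𝟘) (ℕ.<⇒≤pred (toℕ<n d)))

  S-ρ : ∀ {d} → d ≢ 𝟘 → S k (d , false , d)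
  S-ρ {d} d≢𝟘 = subst (S k)
    (trans (ρⁱaⁱ≡ (toℕ d)) (≡³ k (Defs.mod-toℕ k d) refl (Defs.mod-toℕ k d)))
    (ρⁱaⁱ (toℕ d) (1≤toℕ d≢𝟘) (ℕ.<⇒≤pred (toℕ<n d)))

  reach⇒dominates : ∀ {u w} → Reach u w → Dominates u w
  reach⇒dominates {i , b , j} (inj₁ (refl , d , refl , refl)) with d ≟ 𝟘
  ... | yes refl = inj₁ (≡³ k (⊕-twist-𝟘 i b) refl (identityʳ j))
  ... | no d≢𝟘   = inj₂ (_ , S-ρ d≢𝟘 , ≡³ k refl (sym (xor-identityʳ b)) refl)
  reach⇒dominates {i , b , j} {w = _ , _ , j′} (inj₂ (refl , inj₁ (refl , j′≢j))) =
    inj₂ (_ , S-τ {d = ⊖ j ⊕ j′} d≢𝟘 ,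
      ≡³ k (sym (⊕-twist-𝟘 i b)) (sym (xor-true b)) j′≡)
    where
    j′≡ : j′ ≡ j ⊕ (⊖ j ⊕ j′)
    j′≡ = prove (var 1F) (var 0F :+ (:- var 0F :+ var 1F)) refl (j ∷ j′ ∷ [])
    d≢𝟘 : ⊖ j ⊕ j′ ≢ 𝟘
    d≢𝟘 eq = j′≢j (trans j′≡ (trans (cong (j ⊕_) eq) (identityʳ j)))
  reach⇒dominates {i , b , j} (inj₂ (refl , inj₂ (refl , inj₁ refl))) =
    inj₂ (_ , subst (S k) ρτa≡ ρτa , ≡³ k refl (sym (xor-true b)) refl)
  reach⇒dominates {i , b , j} (inj₂ (refl , inj₂ (refl , inj₂ refl))) =
    inj₂ (_ , subst (S k) ρτa⁻¹≡ ρτa⁻¹ , ≡³ k refl (sym (xor-true b)) refl)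

  -- Defence by k + 1 guards

  -- Every clique of the layer false is i − j = 2 l for a unique l, as k is odd;
  -- point m l is the vertex of that clique on the antidiagonal i + j = 2 m.
  point : Fin k → Fin k → G
  point m l = m ⊕ l , false , m ⊕ ⊖ l

  antidiagonal : Fin k → VertexSet
  antidiagonal m (i , false , j) = ⌊ i ⊕ j ≟ m ⊕ m ⌋
  antidiagonal m (i , true  , j) = false

  guarded : Fin k → Fin k × Fin k → VertexSet
  guarded m v (i , false , j) = antidiagonal m (i , false , j)
  guarded m v (i , true  , j) = ⌊ ≡-dec _≟_ _≟_ (i , j) v ⌋

  point∈ : ∀ m l → point m l ∈ antidiagonal m
  point∈ m l = fromWitness
    (prove ((var 0F :+ var 1F) :+ (var 0F :+ :- var 1F)) (var 0F :+ var 0F) refl (m ∷ l ∷ []))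

  point-injective : ∀ m {l l′} → point m l ≡ point m l′ → l ≡ l′
  point-injective m eq = ∙-cancelˡ m _ _ (cong proj₁ eq)

  point-surjective : ∀ m v → v ∈ antidiagonal m → ∃ λ l → point m l ≡ v
  point-surjective m (i , false , j) v∈ = i ⊕ ⊖ m , ≡³ k
    (prove (var 0F :+ (var 1F :+ :- var 0F)) (var 1F) refl (m ∷ i ∷ []))
    refl
    (begin
      m ⊕ ⊖ (i ⊕ ⊖ m)  ≡⟨ prove (var 0F :+ :- (var 1F :+ :- var 0F)) (var 0F :+ var 0F :+ :- var 1F) refl (m ∷ i ∷ []) ⟩
      m ⊕ m ⊕ ⊖ i      ≡⟨ cong (_⊕ ⊖ i) (toWitness v∈) ⟨
      i ⊕ j ⊕ ⊖ i      ≡⟨ prove (var 0F :+ var 1F :+ :- var 0F) (var 1F) refl (i ∷ j ∷ []) ⟩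
      j                ∎)
    where open ≡-Reasoning

  antidiagonal-cardinality : ∀ m → HasCardinality (antidiagonal m) k
  antidiagonal-cardinality m =
    enumerate (point m) (point∈ m) (point-injective m) (point-surjective m)

  position : Fin k → Fin k × Fin k → Fin (suc k) → G
  position m (p , q) zero    = p , true , q
  position m (p , q) (suc l) = point m l

  guarded-cardinality : ∀ m v → HasCardinality (guarded m v) (suc k)
  guarded-cardinality m v = enumerate (position m v) position∈ position-injective position-surjective
    where
    position∈ : ∀ l → position m v l ∈ guarded m v
    position∈ zero    = fromWitness refl
    position∈ (suc l) = point∈ m l
    position-injective : ∀ {l l′} → position m v l ≡ position m v l′ → l ≡ l′
    position-injective {zero}  {zero}   _  = refl
    position-injective {suc l} {suc l′} eq = cong suc (point-injective m eq)
    position-injective {zero}  {suc l′} eq = contradiction (cong (proj₁ ∘ proj₂) eq) λ ()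
    position-injective {suc l} {zero}   eq = contradiction (cong (proj₁ ∘ proj₂) eq) λ ()
    position-surjective : ∀ w → w ∈ guarded m v → ∃ λ l → position m v l ≡ w
    position-surjective (i , false , j) w∈ =
      let l , eq = point-surjective m (i , false , j) w∈ in suc l , eq
    position-surjective (i , true , j) w∈ with refl ← toWitness w∈ = zero , refl

  -- Changing `m` keeps i - j = 2 l fixed, so a whole antidiagonal can move at once, each guard
  -- inside its own clique.
  slide : ∀ m m′ l → SameClique (point m l) (point m′ l)
  slide m m′ l = refl , m′ ⊕ ⊖ m ,
    prove (var 1F :+ var 2F) (var 0F :+ var 2F :+ (var 1F :+ :- var 0F)) refl η ,
    prove (var 1F :+ :- var 2F) (var 0F :+ :- var 2F :+ (var 1F :+ :- var 0F)) refl η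
    where η = m ∷ m′ ∷ l ∷ []

  -- The guard of column `i` reaches the target unless it stands in row `j`. In that case the guard
  -- of column i - 1 stands in row j + 1 and reaches it through ρτa⁻¹.
  point→true : ∀ m i j → ∃ λ l → Cross (point m l) (i , true , j)
  point→true m i j with j ≟ m ⊕ ⊖ (i ⊕ ⊖ m)
  ... | no j≢ = i ⊕ ⊖ m , refl , inj₁
    (prove (var 1F) (var 0F :+ (var 1F :+ :- var 0F)) refl (m ∷ i ∷ []) , j≢)
  ... | yes refl = i ⊕ ⊖ 𝟙 ⊕ ⊖ m , refl , inj₂
    ( prove (var 1F) (var 0F :+ (var 1F :+ :- var 2F :+ :- var 0F) :+ var 2F) refl η
    , inj₂ (prove (var 0F :+ :- (var 1F :+ :- var 0F))
                  (var 0F :+ :- (var 1F :+ :- var 2F :+ :- var 0F) :+ :- var 2F) refl η))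
    where η = m ∷ i ∷ 𝟙 ∷ []

  -- With m = i - l the point of clique `l` lies in column `i`. If its row happens to be `j`, then m
  -- = i - 1 - l puts it one column and one row back instead.
  true→point : ∀ i j l → ∃ λ m → Cross (i , true , j) (point m l)
  true→point i j l with i ⊕ ⊖ l ⊕ ⊖ l ≟ j
  ... | no ≢j = i ⊕ ⊖ l , refl , inj₁
    (prove (var 0F :+ :- var 1F :+ var 1F) (var 0F) refl (i ∷ l ∷ []) , ≢j)
  ... | yes refl = i ⊕ ⊖ 𝟙 ⊕ ⊖ l , refl , inj₂
    ( prove (var 0F :+ :- var 2F :+ :- var 1F :+ var 1F) (var 0F :+ :- var 2F) refl η
    , inj₂ (prove (var 0F :+ :- var 2F :+ :- var 1F :+ :- var 1F)
                  (var 0F :+ :- var 1F :+ :- var 1F :+ :- var 2F) refl η))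
    where η = i ∷ l ∷ 𝟙 ∷ []

  antidiagonal-dominating : ∀ m → IsDominatingSet (antidiagonal m)
  antidiagonal-dominating m (i , true , j) =
    let l , cross = point→true m i j in
    point m l , point∈ m l , reach⇒dominates (inj₂ cross)
  antidiagonal-dominating m (i , false , j) =
    point m l , point∈ m l , reach⇒dominates (inj₁ (refl , i ⊕ ⊖ (m ⊕ l) ,
      prove (var 0F) (var 1F :+ (var 0F :+ :- var 1F)) refl (i ∷ m ⊕ l ∷ []) , (begin
        j                              ≡⟨ prove (var 1F) (var 0F :+ :- (var 0F :+ :- var 1F)) refl (i ∷ j ∷ []) ⟩
        i ⊕ ⊖ (i ⊕ ⊖ j)                ≡⟨ cong (λ x → i ⊕ ⊖ x) (double-half (i ⊕ ⊖ j)) ⟨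
        i ⊕ ⊖ (l ⊕ l)                  ≡⟨ prove (var 0F :+ :- (var 2F :+ var 2F))
                                                (var 1F :+ :- var 2F :+ (var 0F :+ :- (var 1F :+ var 2F)))
                                                refl (i ∷ m ∷ l ∷ []) ⟩
        m ⊕ ⊖ l ⊕ (i ⊕ ⊖ (m ⊕ l))      ∎)))
    where
    open ≡-Reasoning
    l = half (i ⊕ ⊖ j)

  -- Exchanges the roles of the extra guard, labelled `zero`, and of guard `l` of the antidiagonal.
  swap : Fin k → Fin (suc k) ↔ Fin (suc k)
  swap l = transpose zero (suc l)

  Guarded : VertexSet → Set
  Guarded D = ∃ λ m → ∃ λ v → D ≡ guarded m v

  defend : ∀ D → Guarded D → ∀ w → w ∉ D → ∃ λ D′ → Guarded D′ × w ∈ D′ × Reconfigurable D D′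
  defend _ (m , v , refl) (i , false , j) _ =
    guarded m′ v , (m′ , v , refl) , fromWitness (sym (double-half (i ⊕ j))) ,
    reconfigure (guarded-cardinality m v) (guarded-cardinality m′ v) λ where
      zero    → inj₁ refl
      (suc l) → reach⇒dominates (inj₁ (slide m m′ l))
    -- The antidiagonal through the attacked vertex is i + j = 2 m′.
    where m′ = half (i ⊕ j)
  defend _ (m , v , refl) (i , true , j) _ =
    guarded m′ (i , j) , (m′ , (i , j) , refl) , fromWitness refl ,
    reconfigure (guarded-cardinality m v) (↔-trans (swap t) (guarded-cardinality m′ (i , j))) moves
    where
    t = proj₁ (point→true m i j)
    -- The new antidiagonal is one on which the extra guard can reach the clique that guard `t`
    -- abandons.
    m′ = proj₁ (true→point (proj₁ v) (proj₂ v) t)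
    moves : ∀ l → Dominates (position m v l) (position m′ (i , j) (Inverse.to (swap t) l))
    moves zero = reach⇒dominates (inj₂ (proj₂ (true→point (proj₁ v) (proj₂ v) t)))
    moves (suc l) with l ≟ t
    ... | yes refl = reach⇒dominates (inj₂ (proj₂ (point→true m i j)))
    ... | no _     = reach⇒dominates (inj₁ (slide m m′ l))

  guarded-eternal : ∀ m v → IsEternalDominatingSet (guarded m v)
  guarded-eternal m v = Guarded , record
    { nonempty    = guarded m v , m , v , refl
    ; equinumeric = suc k , λ { _ (m′ , v′ , refl) → guarded-cardinality m′ v′ }
    ; defend      = defend
    } , m , v , refl

  -- Dominating sets of at most k guards

  column : G → Fin k
  column = proj₁

  layer : G → Bool
  layer = proj₁ ∘ proj₂

  row : G → Fin k
  row = proj₂ ∘ proj₂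

  -- A step `d` inside a clique changes the column by `twist b d` and the row by `d`, so this
  -- difference labels the clique. The layer is not recorded: cliques of both layers share the same
  -- `k` labels.
  clique : G → Fin k
  clique (i , b , j) = twist b i ⊕ ⊖ j

  sameClique⇒clique≡ : ∀ {u w} → SameClique u w → clique u ≡ clique w
  sameClique⇒clique≡ {i , false , j} (refl , d , refl , refl) =
    prove (var 0F :+ :- var 1F) (var 0F :+ var 2F :+ :- (var 1F :+ var 2F)) refl (i ∷ j ∷ d ∷ [])
  sameClique⇒clique≡ {i , true , j} (refl , d , refl , refl) =
    prove (:- var 0F :+ :- var 1F) (:- (var 0F :+ :- var 2F) :+ :- (var 1F :+ var 2F)) refl (i ∷ j ∷ d ∷ [])

  twist-𝟙≢𝟘 : ∀ b → twist b 𝟙 ≢ 𝟘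
  twist-𝟙≢𝟘 false = 𝟙≢𝟘
  twist-𝟙≢𝟘 true eq = 𝟙≢𝟘 (⁻¹-injective (trans eq (sym ε⁻¹≈ε)))

  count : (Fin m → G) → Bool → ℕ
  count {m} g b = ∑[ l < m ] ι b (layer (g l))

  count-total : (g : Fin m → G) → count g true + count g false ≡ m
  count-total {m} g = begin
    count g true + count g false                               ≡⟨ ∑-distrib-+ (ι true ∘ layer ∘ g) (ι false ∘ layer ∘ g) ⟨
    ∑[ l < m ] (ι true (layer (g l)) + ι false (layer (g l)))  ≡⟨ sum-cong-≗ (ι-total ∘ layer ∘ g) ⟩
    ∑[ l < m ] 1                                               ≡⟨ ∑-const m 1 ⟩
    m * 1                                                      ≡⟨ ℕ.*-identityʳ m ⟩
    m                                                          ∎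
    where open ≡-Reasoning

  CoversCliques : Bool → (Fin m → G) → Set
  CoversCliques b g = ∀ s → ∃ λ l → layer (g l) ≡ b × s ≡ clique (g l)

  coversCliques : {g : Fin m → G} → DominatingFamily g → ∀ b →
                  count g (not b) * 2 < k → CoversCliques b g
  coversCliques {m} {g} dom b few s
    with any? (λ l → (layer (g l) ≟ᵇ b) ×-dec (s ≟ clique (g l)))
  ... | yes found = found
  ... | no ¬found = contradiction few (ℕ.≤⇒≯
    (subst (k ≤_) (sym (*-distribʳ-sum 2 (ι (not b) ∘ layer ∘ g))) (cover-≤ F _ covered ∑F≤)))
    where
    hits : Fin m → Fin k → ℕ
    hits l i = δ i (column (g l)) + δ i (column (g l) ⊕ twist (layer (g l)) 𝟙)
    -- Guards of layer `b` weigh nothing; any other guard has total weight 2, from its own column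
    -- and the neighbouring one.
    F : Fin m → Fin k → ℕ
    F l i = ι (not b) (layer (g l)) * hits l i
    cell : Fin k → G
    cell i = i , b , twist b i ⊕ ⊖ s
    clique-cell : ∀ i → clique (cell i) ≡ s
    clique-cell i =
      prove (var 0F :+ :- (var 0F :+ :- var 1F)) (var 1F) refl (twist b i ∷ s ∷ [])
    1≤hits : ∀ l i → Cross (g l) (cell i) → 1 ≤ hits l i
    1≤hits l i (_ , inj₁ (i≡ , _)) = ℕ.≤-trans (ℕ.≤-reflexive (sym (δ-≡ i≡))) (ℕ.m≤m+n _ _)
    1≤hits l i (_ , inj₂ (i≡ , _)) = ℕ.≤-trans (ℕ.≤-reflexive (sym (δ-≡ i≡))) (ℕ.m≤n+m _ _)
    covered : ∀ i → ∃ λ l → 1 ≤ F l i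
    covered i with dom (cell i)
    ... | l , l-dominates with dominates⇒reach l-dominates
    ...   | inj₁ same = contradiction
      (l , sym (proj₁ same) , sym (trans (sameClique⇒clique≡ same) (clique-cell i))) ¬found
    ...   | inj₂ cross = l , ℕ.*-mono-≤ (ℕ.≤-reflexive (sym ι≡1)) (1≤hits l i cross)
      where
      ι≡1 : ι (not b) (layer (g l)) ≡ 1
      ι≡1 = trans (cong (λ c → ι c (layer (g l)))
                        (trans (cong not (proj₁ cross)) (not-involutive _)))
                  (ι-refl (layer (g l)))
    ∑F≤ : ∀ l → sum (F l) ≤ ι (not b) (layer (g l)) * 2
    ∑F≤ l = ℕ.≤-reflexive (trans (sym (*-distribˡ-sum (ι (not b) (layer (g l))) (hits l)))
      (cong (ι (not b) (layer (g l)) *_)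
        (trans (∑-distrib-+ (λ i → δ i (column (g l))) (λ i → δ i (column (g l) ⊕ twist (layer (g l)) 𝟙)))
               (cong₂ _+_ (∑-δ (column (g l))) (∑-δ (column (g l) ⊕ twist (layer (g l)) 𝟙))))))

  -- Equality `p * 2 ≡ k` would make `k` even.
  smaller-half : ∀ {p q} → p ≤ q → p + q ≤ k → p * 2 < k
  smaller-half {p} {q} p≤q p+q≤k = ℕ.≤∧≢⇒< p*2≤k λ eq →
    contradiction (trans (sym odd) (trans (cong (_% 2) (sym eq)) (m*n%n≡0 p 2))) λ ()
    where
    p*2≤k : p * 2 ≤ k
    p*2≤k = ℕ.≤-trans (ℕ.≤-reflexive (trans (ℕ.*-comm p 2) (cong (p +_) (ℕ.+-identityʳ p))))
            (ℕ.≤-trans (ℕ.+-monoʳ-≤ p p≤q) p+q≤k)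

  -- The layer with at least as many guards is covered, since the other one holds fewer than k / 2.
  coversSomeLayer : {g : Fin m → G} → DominatingFamily g → m ≤ k →
                    ∃ λ b → CoversCliques b g
  coversSomeLayer {m} {g} dom m≤k with ℕ.≤-total (count g true) (count g false)
  ... | inj₁ ≤false = false , coversCliques dom false
    (smaller-half ≤false (subst (_≤ k) (sym (count-total g)) m≤k))
  ... | inj₂ ≤true = true , coversCliques dom true
    (smaller-half ≤true (subst (_≤ k) (sym (trans (ℕ.+-comm (count g false) _) (count-total g))) m≤k))

  -- Choosing a guard for each of the `k` clique labels is injective, as a guard determines its
  -- label.
  k≤dominating : {g : Fin m → G} → DominatingFamily g → k ≤ m
  k≤dominating {m} {g} dom with ℕ.≤-total k m
  ... | inj₁ k≤m = k≤m
  ... | inj₂ m≤k with b , covers ← coversSomeLayer dom m≤k =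
    injective⇒≤ {f = proj₁ ∘ covers} λ {s} {s′} eq →
      trans (proj₂ (proj₂ (covers s)))
            (trans (cong (clique ∘ g) eq) (sym (proj₂ (proj₂ (covers s′)))))

  record Layered (b : Bool) (g : Fin k → G) : Set where
    field
      dominating       : DominatingFamily g
      layer≡           : ∀ l → layer (g l) ≡ b
      clique-injective : ∀ {l l′} → clique (g l) ≡ clique (g l′) → l ≡ l′

  -- Guards of layer `b` alone already make `clique ∘ g` onto, hence injective on all `k` guards. So
  -- every guard is the guard of layer `b` that shares its label.
  layered : {g : Fin k → G} → DominatingFamily g → ∃ λ b → Layered b g
  layered {g} dom with b , covers ← coversSomeLayer dom ℕ.≤-refl = b , record
    { dominating       = dom
    ; layer≡           = λ l → let l′ , layer≡b , clique≡ = covers (clique (g l)) in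
        trans (cong (layer ∘ g) (injective clique≡)) layer≡b
    ; clique-injective = injective }
    where
    injective : ∀ {l l′} → clique (g l) ≡ clique (g l′) → l ≡ l′
    injective = surjective⇒injective {x = clique ∘ g} (λ s → let l , _ , s≡ = covers s in l , s≡)

  ℤ/-induction : (P : Fin k → Set) → P 𝟘 → (∀ {i} → P i → P (i ⊕ 𝟙)) → ∀ i → P i
  ℤ/-induction P P0 P+1 i = subst P (Defs.mod-toℕ k i) (go (toℕ i))
    where
    go : ∀ n → P (n mod k)
    go zero    = P0
    go (suc n) = subst P (trans (Defs.mod-+ k n 1) (cong (_mod k) (ℕ.+-comm n 1))) (P+1 (go n))

  -- The shape of `k` dominating guards: one per column, along a line.

  module LayeredProperties {b : Bool} {g : Fin k → G} (g-layered : Layered b g) where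
    open Layered g-layered

    σ : Fin k
    σ = twist b 𝟙

    x y : Fin k → Fin k
    x = column ∘ g
    y = row ∘ g

    x≢x⊕σ : ∀ {l} → x l ≢ x l ⊕ σ
    x≢x⊕σ {l} eq = twist-𝟙≢𝟘 b (identityʳ-unique (x l) σ (sym eq))

    Crosses : Fin k → Fin k → Fin k → Set
    Crosses l i j = (i ≡ x l × j ≢ y l) ⊎ (i ≡ x l ⊕ σ × (j ≡ y l ⊕ 𝟙 ⊎ j ≡ y l ⊕ ⊖ 𝟙))

    crosses : ∀ l {w} → layer w ≡ not b → Dominates (g l) w → Crosses l (column w) (row w)
    crosses l layer-w l-dominates with dominates⇒reach l-dominates
    ... | inj₁ (same , _) = contradiction (trans (sym (trans same (layer≡ l))) layer-w) (not-¬ refl)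
    ... | inj₂ (_ , inj₁ c) = inj₁ c
    ... | inj₂ (_ , inj₂ (i≡ , j≡)) =
      inj₂ (trans i≡ (cong (λ c → x l ⊕ twist c 𝟙) (layer≡ l)) , j≡)

    dominated : ∀ i j → ∃ λ l → Crosses l i j
    dominated i j with l , l-dominates ← dominating (i , not b , j) = l , crosses l refl l-dominates

    -- Every generator that changes the layer also changes the row.
    crosses⇒≢ : ∀ {l i j} → Crosses l i j → j ≢ y l
    crosses⇒≢ (inj₁ (_ , j≢)) = j≢
    crosses⇒≢ {l} (inj₂ (_ , inj₁ j≡)) eq = 𝟙≢𝟘 (identityʳ-unique (y l) 𝟙 (trans (sym j≡) eq))
    crosses⇒≢ {l} (inj₂ (_ , inj₂ j≡)) eq =
      twist-𝟙≢𝟘 true (identityʳ-unique (y l) (⊖ 𝟙) (trans (sym j≡) eq))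

    crosses⇒1≤δ+δ : ∀ {l i j} → Crosses l i j → 1 ≤ δ i (x l) + δ i (x l ⊕ σ)
    crosses⇒1≤δ+δ (inj₁ (i≡ , _)) = ℕ.≤-trans (ℕ.≤-reflexive (sym (δ-≡ i≡))) (ℕ.m≤m+n _ _)
    crosses⇒1≤δ+δ (inj₂ (i≡ , _)) = ℕ.≤-trans (ℕ.≤-reflexive (sym (δ-≡ i≡))) (ℕ.m≤n+m _ _)

    -- The guard dominating (i , not b , 𝟘) does not dominate the vertex of
    -- column i in its own row, so a second guard is needed for that vertex.
    fibre+fibre≡2 : ∀ i → fibre x i + fibre (λ l → x l ⊕ σ) i ≡ 2
    fibre+fibre≡2 = ∑-tight at-least-2 (begin
      ∑[ i < k ] (fibre x i + fibre (λ l → x l ⊕ σ) i)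
        ≡⟨ ∑-distrib-+ (fibre x) (fibre (λ l → x l ⊕ σ)) ⟩
      ∑[ i < k ] fibre x i + ∑[ i < k ] fibre (λ l → x l ⊕ σ) i
        ≡⟨ cong₂ _+_ (∑-fibre x) (∑-fibre (λ l → x l ⊕ σ)) ⟩
      k + k
        ≡⟨ cong (k +_) (ℕ.+-identityʳ k) ⟨
      2 * k
        ≡⟨ ℕ.*-comm 2 k ⟩
      k * 2 ∎)
      where
      open ≡-Reasoning
      at-least-2 : ∀ i → 2 ≤ fibre x i + fibre (λ l → x l ⊕ σ) i
      at-least-2 i with l , l-crosses ← dominated i 𝟘 with l′ , l′-crosses ← dominated i (y l) =
        subst (2 ≤_) (∑-distrib-+ (λ l → δ i (x l)) (λ l → δ i (x l ⊕ σ)))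
          (2≤∑ (λ l≡l′ → crosses⇒≢ l′-crosses (cong y l≡l′))
               (crosses⇒1≤δ+δ l-crosses) (crosses⇒1≤δ+δ l′-crosses))

    fibre-shift : ∀ i → fibre (λ l → x l ⊕ σ) (i ⊕ σ) ≡ fibre x i
    fibre-shift i = sum-cong-≗ λ l → ℕ.≤-antisym
      (δ-≤ (λ eq → ℕ.≤-reflexive (sym (δ-≡ (∙-cancelʳ σ i (x l) eq)))))
      (δ-≤ (λ eq → ℕ.≤-reflexive (sym (δ-≡ (cong (_⊕ σ) eq)))))

    fibre+fibre-next≡2 : ∀ i → fibre x (i ⊕ σ) + fibre x i ≡ 2
    fibre+fibre-next≡2 i =
      trans (cong (fibre x (i ⊕ σ) +_) (sym (fibre-shift i))) (fibre+fibre≡2 (i ⊕ σ))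

    -- Occupancies of neighbouring columns add up to 2, so they alternate with period two.
    fibre-two-steps : ∀ i → fibre x (i ⊕ σ ⊕ σ) ≡ fibre x i
    fibre-two-steps i = ℕ.+-cancelʳ-≡ (fibre x (i ⊕ σ)) _ _ (trans (fibre+fibre-next≡2 (i ⊕ σ))
      (trans (sym (fibre+fibre-next≡2 i)) (ℕ.+-comm (fibre x (i ⊕ σ)) (fibre x i))))

    fibre-even : ∀ d → fibre x (twist b (d ⊕ d)) ≡ fibre x 𝟘
    fibre-even = ℤ/-induction _
      (cong (fibre x) (trans (cong (twist b) 𝟘⊕𝟘) (twist-0 k b)))
      (λ {d} eq → trans (cong (fibre x) (two-steps b d)) (trans (fibre-two-steps _) eq))
      where
      two-steps : ∀ b d → twist b ((d ⊕ 𝟙) ⊕ (d ⊕ 𝟙)) ≡ twist b (d ⊕ d) ⊕ twist b 𝟙 ⊕ twist b 𝟙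
      two-steps false d = prove ((var 0F :+ var 1F) :+ (var 0F :+ var 1F))
        (var 0F :+ var 0F :+ var 1F :+ var 1F) refl (d ∷ 𝟙 ∷ [])
      two-steps true d = prove (:- ((var 0F :+ var 1F) :+ (var 0F :+ var 1F)))
        (:- (var 0F :+ var 0F) :+ :- var 1F :+ :- var 1F) refl (d ∷ 𝟙 ∷ [])

    -- As `k` is odd, every column is an even multiple of `σ`, so going in double steps from column
    -- 𝟘 reaches all of them.
    fibre-constant : ∀ i → fibre x i ≡ fibre x 𝟘
    fibre-constant i = trans (cong (fibre x) (sym (halved b))) (fibre-even (half (twist b i)))
      where
      halved : ∀ b → twist b (half (twist b i) ⊕ half (twist b i)) ≡ i
      halved b = trans (cong (twist b) (double-half (twist b i)))
        (trans (Defs.twist-twist k b b i) (cong (λ c → twist c i) (xor-same b)))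

    fibre≡1 : ∀ i → fibre x i ≡ 1
    fibre≡1 i = trans (fibre-constant i) (ℕ.*-cancelˡ-≡ (fibre x 𝟘) 1 k (begin
      k * fibre x 𝟘          ≡⟨ ∑-const k (fibre x 𝟘) ⟨
      ∑[ i < k ] fibre x 𝟘   ≡⟨ sum-cong-≗ fibre-constant ⟨
      ∑[ i < k ] fibre x i   ≡⟨ ∑-fibre x ⟩
      k                      ≡⟨ ℕ.*-identityʳ k ⟨
      k * 1                  ∎))
      where open ≡-Reasoning

    x-injective : ∀ {l l′} → x l ≡ x l′ → l ≡ l′
    x-injective {l} eq = fibre-unique x (fibre≡1 (x l)) refl eq

    x-surjective : ∀ i → ∃ λ l → i ≡ x l
    x-surjective i with l , 1≤δ ← ∑-positive (ℕ.≤-reflexive (sym (fibre≡1 i))) = l , ≤-δ 1≤δ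

    -- The guard of column i ⊕ σ leaves the opposite vertex to the guard of
    -- column i; moving up instead of down would put both in one clique.
    y-step : ∀ {l l′} → x l′ ≡ x l ⊕ σ → y l′ ≡ y l ⊕ ⊖ 𝟙
    y-step {l} {l′} next =
      let l″ , l″-crosses = dominated (x l′) (y l′) in [ opposite , below ]′ l″-crosses
      where
      opposite : ∀ {l″} → x l′ ≡ x l″ × y l′ ≢ y l″ → y l′ ≡ y l ⊕ ⊖ 𝟙
      opposite (x≡ , y≢) = contradiction (cong y (x-injective x≡)) y≢
      below : ∀ {l″} → x l′ ≡ x l″ ⊕ σ × (y l′ ≡ y l″ ⊕ 𝟙 ⊎ y l′ ≡ y l″ ⊕ ⊖ 𝟙) → y l′ ≡ y l ⊕ ⊖ 𝟙
      below {l″} (x≡ , y≡) = [ up , (λ down → trans down (cong (λ l → y l ⊕ ⊖ 𝟙) l″≡l)) ]′ y≡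
        where
        l″≡l : l″ ≡ l
        l″≡l = x-injective (∙-cancelʳ σ (x l″) (x l) (trans (sym x≡) next))
        up : y l′ ≡ y l″ ⊕ 𝟙 → y l′ ≡ y l ⊕ ⊖ 𝟙
        up y≡+ = contradiction (trans (cong x (clique-injective (sameClique⇒clique≡ same))) x≡) x≢x⊕σ
          where
          same : SameClique (g l″) (g l′)
          same = trans (layer≡ l′) (sym (layer≡ l″)) , 𝟙 ,
                 trans x≡ (cong (λ c → x l″ ⊕ twist c 𝟙) (sym (layer≡ l″))) , y≡+

  -- Guards moving from one layer to the other.

  module Crossing {b : Bool} {g g′ : Fin k → G}
                  (g-layered : Layered b g) (g′-layered : Layered (not b) g′)
                  (moves : ∀ l → Dominates (g l) (g′ l)) where
    open LayeredProperties g-layered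
    module P′ = LayeredProperties g′-layered
    open P′ using () renaming (x to x′; y to y′; σ to σ′)

    σ⊕σ′≡𝟘 : ∀ b → twist b 𝟙 ⊕ twist (not b) 𝟙 ≡ 𝟘
    σ⊕σ′≡𝟘 false = inverseʳ 𝟙
    σ⊕σ′≡𝟘 true  = Defs.⊖-inverseˡ k 𝟙

    -- Since σ′ = -σ, the rows of `g′` rise by one in the direction in which those of `g` fall by
    -- one.
    y′-step : ∀ {l l′} → x′ l′ ≡ x′ l ⊕ σ → y′ l ≡ y′ l′ ⊕ ⊖ 𝟙
    y′-step {l} {l′} next = P′.y-step (begin
      x′ l               ≡⟨ identityʳ (x′ l) ⟨
      x′ l ⊕ 𝟘           ≡⟨ cong (x′ l ⊕_) (σ⊕σ′≡𝟘 b) ⟨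
      x′ l ⊕ (σ ⊕ σ′)    ≡⟨ Defs.⊕-assoc k (x′ l) σ σ′ ⟨
      x′ l ⊕ σ ⊕ σ′      ≡⟨ cong (_⊕ σ′) next ⟨
      x′ l′ ⊕ σ′         ∎)
      where open ≡-Reasoning

    move : ∀ l → Crosses l (x′ l) (y′ l)
    move l = crosses l (Layered.layer≡ g′-layered l) (moves l)

    Shifted : Fin k → Set
    Shifted l = x′ l ≡ x l ⊕ σ × (y′ l ≡ y l ⊕ 𝟙 ⊎ y′ l ≡ y l ⊕ ⊖ 𝟙)

    -- Staying in its column, the next guard would run into the first one.
    shift-next : ∀ {l l′} → x′ l ≡ x l ⊕ σ → x l′ ≡ x l ⊕ σ → Shifted l′
    shift-next {l} {l′} shifted next = [ (λ (stays , _) → collision stays) , id ]′ (move l′)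
      where
      collision : x′ l′ ≡ x l′ → Shifted l′
      collision stays = contradiction (trans (cong x l≡l′) next) x≢x⊕σ
        where
        l≡l′ : l ≡ l′
        l≡l′ = P′.x-injective (trans shifted (trans (sym next) (sym stays)))

    -- Guards `l`, `l₀`, `l₂` end in consecutive columns, so y′ l₂ = y l₀ + 2, whereas y l₂ = y l₀ -
    -- 1. Guard `l₂` would change its row by 3, and 3 = 1 or 3 = -1 gives 2 = 0 or 4 = 0, impossible
    -- for odd k > 1.
    no-consecutive-shifts : ∀ {l l₀ l₂} → x′ l ≡ x l₀ → y′ l ≡ y l₀ → x l₂ ≡ x l₀ ⊕ σ →
                            Shifted l₀ → ¬ Shifted l₂
    no-consecutive-shifts {l} {l₀} {l₂} x′l≡ y′l≡ next (shifted₀ , _) (shifted₂ , y′l₂≡) =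
      impossible y′l₂≡
      where
      open ≡-Reasoning
      r≡ : y l₀ ≡ y′ l₂ ⊕ ⊖ 𝟙 ⊕ ⊖ 𝟙
      r≡ = begin
        y l₀                    ≡⟨ y′l≡ ⟨
        y′ l                    ≡⟨ y′-step (trans shifted₀ (cong (_⊕ σ) (sym x′l≡))) ⟩
        y′ l₀ ⊕ ⊖ 𝟙             ≡⟨ cong (_⊕ ⊖ 𝟙) (y′-step (trans shifted₂ (cong (_⊕ σ) (trans next (sym shifted₀))))) ⟩
        y′ l₂ ⊕ ⊖ 𝟙 ⊕ ⊖ 𝟙       ∎
      y≡ : y l₂ ≡ y l₀ ⊕ ⊖ 𝟙
      y≡ = y-step next
      impossible : ¬ (y′ l₂ ≡ y l₂ ⊕ 𝟙 ⊎ y′ l₂ ≡ y l₂ ⊕ ⊖ 𝟙)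
      impossible (inj₁ up) = 𝟚≢𝟘 (begin
        𝟙 ⊕ 𝟙                                         ≡⟨ prove (var 1F :+ var 1F)
                                                          (var 0F :+ :- (var 0F :+ :- var 1F :+ var 1F :+ :- var 1F :+ :- var 1F))
                                                          refl (y l₀ ∷ 𝟙 ∷ []) ⟩
        y l₀ ⊕ ⊖ (y l₀ ⊕ ⊖ 𝟙 ⊕ 𝟙 ⊕ ⊖ 𝟙 ⊕ ⊖ 𝟙)         ≡⟨ cong (λ v → y l₀ ⊕ ⊖ (v ⊕ ⊖ 𝟙 ⊕ ⊖ 𝟙)) (trans up (cong (_⊕ 𝟙) y≡)) ⟨
        y l₀ ⊕ ⊖ (y′ l₂ ⊕ ⊖ 𝟙 ⊕ ⊖ 𝟙)                  ≡⟨ cong (λ v → y l₀ ⊕ ⊖ v) r≡ ⟨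
        y l₀ ⊕ ⊖ y l₀                                 ≡⟨ inverseʳ (y l₀) ⟩
        𝟘                                             ∎)
      impossible (inj₂ down) = 𝟜≢𝟘 (begin
        (𝟙 ⊕ 𝟙) ⊕ (𝟙 ⊕ 𝟙)                             ≡⟨ prove ((var 1F :+ var 1F) :+ (var 1F :+ var 1F))
                                                          (var 0F :+ :- (var 0F :+ :- var 1F :+ :- var 1F :+ :- var 1F :+ :- var 1F))
                                                          refl (y l₀ ∷ 𝟙 ∷ []) ⟩
        y l₀ ⊕ ⊖ (y l₀ ⊕ ⊖ 𝟙 ⊕ ⊖ 𝟙 ⊕ ⊖ 𝟙 ⊕ ⊖ 𝟙)       ≡⟨ cong (λ v → y l₀ ⊕ ⊖ (v ⊕ ⊖ 𝟙 ⊕ ⊖ 𝟙)) (trans down (cong (_⊕ ⊖ 𝟙) y≡)) ⟨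
        y l₀ ⊕ ⊖ (y′ l₂ ⊕ ⊖ 𝟙 ⊕ ⊖ 𝟙)                  ≡⟨ cong (λ v → y l₀ ⊕ ⊖ v) r≡ ⟨
        y l₀ ⊕ ⊖ y l₀                                 ≡⟨ inverseʳ (y l₀) ⟩
        𝟘                                             ∎)

    -- A defender from the same column would be `l₀` itself, which cannot cross within its row. A
    -- defender from the preceding column forces `l₀` to shift, as no two guards of `g′` share a
    -- column, and `l₀` in turn forces the guard after it.
    opposite-undefended : ∀ l₀ l → x′ l ≡ x l₀ → y′ l ≢ y l₀
    opposite-undefended l₀ l x′l≡ y′l≡ = [ stay , (λ (shifted , _) → shift shifted) ]′ (move l)
      where
      stay : ¬ (x′ l ≡ x l × y′ l ≢ y l)
      stay (stays , y′≢) = y′≢ (trans y′l≡ (cong y (x-injective (trans (sym x′l≡) stays))))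
      shift : x′ l ≢ x l ⊕ σ
      shift shifted = no-consecutive-shifts x′l≡ y′l≡ next shifted₀ (shift-next (proj₁ shifted₀) next)
        where
        next = sym (proj₂ (x-surjective (x l₀ ⊕ σ)))
        shifted₀ : Shifted l₀
        shifted₀ = shift-next shifted (trans (sym x′l≡) shifted)

  -- The failure of `k` guards, and the values of the two domination numbers.

  ¬k-eternal : ∀ {𝒟} → IsEternalConfiguration 𝒟 → ∀ D → 𝒟 D → ¬ HasCardinality D k
  ¬k-eternal {𝒟} 𝒟-eternal D D∈𝒟 e = attack (layered (dominatingFamily (𝒟-dominating D D∈𝒟) e))
    where
    𝒟-dominating : ∀ D → 𝒟 D → IsDominatingSet D
    𝒟-dominating = configuration-dominating 𝒟-eternal
    g : Fin k → G
    g l = proj₁ (Inverse.to e l)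
    attack : ¬ ∃ λ b → Layered b g
    attack (b , g-layered) = respond (IsEternalConfiguration.defend 𝒟-eternal D D∈𝒟 w w∉D)
      where
      w : G
      -- The attacked vertex lies opposite to a guard; the label 𝟘 is an arbitrary choice.
      w = column (g 𝟘) , not b , row (g 𝟘)
      w∉D : w ∉ D
      w∉D w∈D = not-¬ refl (trans (sym (Layered.layer≡ g-layered (Inverse.from e (w , w∈D))))
        (cong (layer ∘ proj₁) (Inverse.strictlyInverseˡ e (w , w∈D))))
      respond : ¬ ∃ λ D′ → 𝒟 D′ × w ∈ D′ × Reconfigurable D D′
      respond (D′ , D′∈𝒟 , w∈D′ , f , moves) = compare (layered (dominatingFamily (𝒟-dominating D′ D′∈𝒟) e′))
        where
        -- Guards are labelled so that each keeps its label when it moves.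
        e′ : HasCardinality D′ k
        e′ = ↔-trans e f
        g′ : Fin k → G
        g′ l = proj₁ (Inverse.to e′ l)
        l : Fin k
        l = Inverse.from e′ (w , w∈D′)
        g′l≡w : g′ l ≡ w
        g′l≡w = cong proj₁ (Inverse.strictlyInverseˡ e′ (w , w∈D′))
        compare : ¬ ∃ λ b′ → Layered b′ g′
        compare (b′ , g′-layered) = Crossing.opposite-undefended g-layered
          (subst (λ c → Layered c g′) b′≡ g′-layered) (λ l → moves (Inverse.to e l))
          𝟘 l (cong column g′l≡w) (cong row g′l≡w)
          where
          -- All guards of `D′` share one layer, which must be that of `w`.
          b′≡ : b′ ≡ not b
          b′≡ = trans (sym (Layered.layer≡ g′-layered l)) (cong layer g′l≡w)

  eternal⇒k<m : ∀ {D} → IsEternalDominatingSet D → HasCardinality D m → k < m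
  eternal⇒k<m {D = D} (𝒟 , 𝒟-eternal , D∈𝒟) e = ℕ.≤∧≢⇒<
    (k≤dominating (dominatingFamily (configuration-dominating 𝒟-eternal D D∈𝒟) e))
    λ { refl → ¬k-eternal 𝒟-eternal D D∈𝒟 e }

  isDominationNumber : IsDominationNumber (Γ k) k
  isDominationNumber =
    (antidiagonal 𝟘 , antidiagonal-dominating 𝟘 , antidiagonal-cardinality 𝟘) ,
    λ m (D , D-dominating , e) → k≤dominating (dominatingFamily D-dominating e)

  isEternalDominationNumber : IsEternalDominationNumber (Γ k) (suc k)
  isEternalDominationNumber =
    (guarded 𝟘 (𝟘 , 𝟘) , guarded-eternal 𝟘 (𝟘 , 𝟘) , guarded-cardinality 𝟘 (𝟘 , 𝟘)) ,
    λ m (D , D-eternal , e) → eternal⇒k<m D-eternal e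

theorem4p8 : ∀ (k : ℕ) .{{_ : NonZero k}} → 1 < k → k % 2 ≡ 1 →
    ∃ λ γ → IsDominationNumber (Γ k) γ × IsEternalDominationNumber (Γ k) (γ + 1)
theorem4p8 k 1<k odd = k , isDominationNumber ,
  subst (IsEternalDominationNumber (Γ k)) (sym (ℕ.+-comm k 1)) isEternalDominationNumber
  where open OddOrder k 1<k odd
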